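{- If $p\ge k\ge3$, then the broom $\mathcal B_{k,p}$ has no Braess edge joining a vertex of the path part to a pendent vertex of the star part; that is, $B_2=0$.
   Context: For $k\ge3$ and $p\ge2$, the broom $\mathcal B_{k,p}$ is obtained from the path $\mathcal P_k=(1,\dots,k)$ and a star with $p$ leaves by identifying vertex $k$ of the path with the star's center; the $p$ leaves are the pendent vertices of the star part. $B_2$ denotes the number of Braess edges of $\mathcal B_{k,p}$ joining a vertex of $\mathcal P_k$ to a pendent vertex of the star part. For a connected graph $G$, $\kappa(G)$ is Kemeny's constant of the simple random walk on $G$: $\kappa(G)=\sum_{j\ne i}m_{ij}\pi_j$ ($m_{ij}$ mean first passage time, $\pi$ stationary distribution); a pair of nonadjacent vertices is a Braess edge if adding the edge between them strictly increases $\kappa$. -}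

module Defs where

open import Data.Bool using (Bool; true; false; _∧_; _∨_; if_then_else_)
open import Data.Nat as ℕ using (ℕ; zero; suc; _<ᵇ_; _≡ᵇ_)
open import Data.Fin using (Fin; toℕ; _≟_)
import Data.Fin as F
open import Data.Integer using (+_)
open import Data.Rational using (ℚ; 0ℚ; 1ℚ; _+_; _*_; _/_)
open import Relation.Nullary.Decidable using (⌊_⌋; ¬?)

-- A (simple, undirected, loopless) graph on vertex set Fin n, given by a Boolean
-- adjacency function (assumed symmetric and irreflexive by construction).
Graph : ℕ → Set
Graph n = Fin n → Fin n → Bool

Σ : ∀ {n} → (Fin n → ℚ) → ℚ
Σ {zero}  f = 0ℚ
Σ {suc n} f = f F.zero + Σ (λ i → f (F.suc i))

b2q : Bool → ℚ
b2q true  = 1ℚ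
b2q false = 0ℚ

b2n : Bool → ℕ
b2n true  = 1
b2n false = 0

sumℕ : ∀ {n} → (Fin n → ℕ) → ℕ
sumℕ {zero}  f = 0
sumℕ {suc n} f = f F.zero ℕ.+ sumℕ (λ i → f (F.suc i))

deg : ∀ {n} → Graph n → Fin n → ℕ
deg G i = sumℕ (λ j → b2n (G i j))

twiceEdges : ∀ {n} → Graph n → ℕ
twiceEdges G = sumℕ (deg G)

-- 1/m for m ≥ 1 (and 0 for m = 0, never used for connected graphs)
inv : ℕ → ℚ
inv zero    = 0ℚ
inv (suc m) = (+ 1) / suc m

P : ∀ {n} → Graph n → Fin n → Fin n → ℚ
P G i j = b2q (G i j) * inv (deg G i)

π : ∀ {n} → Graph n → Fin n → ℚ
π G j = (+ deg G j) / 1 * inv (twiceEdges G)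

off : ∀ {n} → Fin n → Fin n → ℚ → ℚ
off i j x = if ⌊ i ≟ j ⌋ then 0ℚ else x

-- m is the matrix of mean first passage times of the simple random walk on G:
-- for i ≠ j,  m i j = 1 + Σ_{l ≠ j} P i l * m l j  (first-step analysis).
IsMFPT : ∀ {n} → Graph n → (Fin n → Fin n → ℚ) → Set
IsMFPT G m = ∀ i j → ⌊ i ≟ j ⌋ ≡ false →
  m i j ≡ 1ℚ + Σ (λ l → off l j (P G i l * m l j))
  where open import Relation.Binary.PropositionalEquality using (_≡_)

kemenyAt : ∀ {n} → Graph n → (Fin n → Fin n → ℚ) → Fin n → ℚ
kemenyAt G m i = Σ (λ j → off i j (m i j * π G j))

addEdge : ∀ {n} → Graph n → Fin n → Fin n → Graph n
addEdge G u v a b =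
  G a b ∨ (⌊ a ≟ u ⌋ ∧ ⌊ b ≟ v ⌋) ∨ (⌊ a ≟ v ⌋ ∧ ⌊ b ≟ u ⌋)

-- The broom B_{k,p} on Fin (k + p): vertex with index x < k is path vertex x+1
-- (so index k-1 is path vertex k = star center); indices k, …, k+p-1 are the
-- p pendent vertices of the star part.
broomAdj : ℕ → ℕ → ℕ → Bool
broomAdj k x y =
  ((x <ᵇ k) ∧ (y <ᵇ k) ∧ ((suc x ≡ᵇ y) ∨ (suc y ≡ᵇ x)))
  ∨ ((suc x ≡ᵇ k) ∧ (k ℕ.≤ᵇ y))
  ∨ ((suc y ≡ᵇ k) ∧ (k ℕ.≤ᵇ x))

broom : (k p : ℕ) → Graph (k ℕ.+ p)
broom k p a b = broomAdj k (toℕ a) (toℕ b)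

{-# OPTIONS --safe #-}
module Submission where

-- Kemeny's constant of a graph with m edges is (1/4m) Σ_{a,b} d_a d_b R_ab, where R is the
-- effective-resistance matrix; this follows from the first-step equations for any R with
-- L R = v 𝟙ᵀ - 2 I.  Adding the edge uv raises the degrees of u and v by one and changes R by
-- the rank-one correction R′_ab = R_ab - (α_a - α_b)² / (1 + R_uv), α = (R_·v - R_·u) / 2.
-- For the broom, R is the distance in the tree, so all these sums are polynomials in t = k - 2,
-- p and the index of u, and 2m (2m + 2) (1 + R_uv) (κ - κ′) is half of a polynomial which, once
-- p = k + b and the position of u are substituted, has nonnegative coefficients only.

open import Defs
open import Data.Nat using (ℕ; _<_)
open import Data.Fin using (Fin; toℕ)
open import Data.Bool using (false)
open import Data.Rational using (ℚ)
open import Relation.Binary.PropositionalEquality using (_≡_)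

open import Data.Bool.Base using (Bool; true; T; not; _∧_; _∨_; if_then_else_)
import Data.Bool.Properties as Boolₚ
open import Data.Empty using (⊥-elim)
open import Data.Fin.Base using (zero; suc)
import Data.Fin.Properties as Finₚ
import Data.Integer.Base as ℤ
import Data.Integer.Properties as ℤₚ
open import Data.List.Base using (List; []; _∷_)
open import Data.Maybe.Base using (Maybe; just; nothing)
open import Data.Nat.Base as ℕ using (zero; suc; z≤n; s≤s; _<ᵇ_; _≤ᵇ_; _≡ᵇ_; ∣_-_∣; _⊓_)
import Data.Nat.Properties as ℕₚ
open import Data.Rational.Base as ℚ using (0ℚ; 1ℚ; ½; _+_; _*_; _-_; -_; _/_; _≤_; toℚᵘ)
import Data.Rational.Properties as ℚₚ
import Data.Rational.Unnormalised.Base as ℚᵘ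
import Data.Rational.Unnormalised.Properties as ℚᵘₚ
open import Data.Sum.Base using (inj₁; inj₂)
open import Data.Unit.Base using (⊤; tt)
open import Function.Base using (_∘_)
open import Level using (0ℓ)
open import Relation.Binary.Definitions using (tri<; tri≈; tri>)
open import Relation.Binary.PropositionalEquality using (refl; sym; trans; cong; cong₂; subst; _≢_; module ≡-Reasoning)
open import Relation.Nullary using (yes; no; ¬_)
open import Relation.Nullary.Decidable using (⌊_⌋)
open import Tactic.RingSolver using (solve-∀)
import Tactic.RingSolver.Core.AlmostCommutativeRing as ACR
open import Tactic.RingSolver.Core.Expression as E using (Expr)
import Tactic.RingSolver.NonReflective as NonReflective

ringℚ : ACR.AlmostCommutativeRing 0ℓ 0ℓ
ringℚ = ACR.fromCommutativeRing ℚₚ.+-*-commutativeRing isZero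
  where
  isZero : (x : ℚ) → Maybe (0ℚ ≡ x)
  isZero x with x ℚₚ.≟ 0ℚ
  ... | yes x≡0 = just (sym x≡0)
  ... | no _    = nothing

literal : ℕ → ℚ
literal n = ℤ.+ n / 1

2ℚ ⅙ : ℚ
2ℚ = literal 2
⅙  = ℤ.+ 1 / 6

-- An opaque copy of literal, so that unification and the ring solver treat fromℕ n as an atom.
opaque
  fromℕ : ℕ → ℚ
  fromℕ = literal

opaque
  unfolding fromℕ

  fromℕ-0 : fromℕ 0 ≡ 0ℚ
  fromℕ-0 = refl

  fromℕ-1 : fromℕ 1 ≡ 1ℚ
  fromℕ-1 = refl

  fromℕ-2 : fromℕ 2 ≡ 2ℚ
  fromℕ-2 = refl

  π-fromℕ : ∀ {n} (G : Graph n) j → π G j ≡ fromℕ (deg G j) * inv (twiceEdges G)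
  π-fromℕ G j = refl

  fromℕ-nonNeg : ∀ n → 0ℚ ≤ fromℕ n
  fromℕ-nonNeg n = ℚₚ.nonNegative⁻¹ (fromℕ n) {{ℚₚ.normalize-nonNeg n 1}}

  fromℕ-suc-pos : ∀ n → 0ℚ ℚ.< fromℕ (suc n)
  fromℕ-suc-pos n = ℚₚ.positive⁻¹ (fromℕ (suc n)) {{ℚₚ.normalize-pos (suc n) 1}}

  fromℕ-suc : ∀ n → fromℕ (suc n) ≡ 1ℚ + fromℕ n
  fromℕ-suc n = ℚₚ.toℚᵘ-injective (begin
    toℚᵘ (fromℕ (suc n))             ≈⟨ ℚₚ.toℚᵘ-fromℚᵘ 1+n ⟩
    1+n                              ≈⟨ ℚᵘ.*≡* cross-multiplied ⟩
    one ℚᵘ.+ n′                      ≈⟨ ℚᵘₚ.+-cong (ℚₚ.toℚᵘ-fromℚᵘ one) (ℚₚ.toℚᵘ-fromℚᵘ n′) ⟨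
    toℚᵘ 1ℚ ℚᵘ.+ toℚᵘ (fromℕ n)      ≈⟨ ℚₚ.toℚᵘ-homo-+ 1ℚ (fromℕ n) ⟨
    toℚᵘ (1ℚ + fromℕ n)              ∎)
    where
    open ℚᵘₚ.≃-Reasoning
    1+n one n′ : ℚᵘ.ℚᵘ
    1+n = ℚᵘ.mkℚᵘ (ℤ.+ suc n) 0
    one = ℚᵘ.mkℚᵘ (ℤ.+ 1) 0
    n′  = ℚᵘ.mkℚᵘ (ℤ.+ n) 0
    cross-multiplied : ℚᵘ.↥ 1+n ℤ.* ℚᵘ.↧ (one ℚᵘ.+ n′) ≡ ℚᵘ.↥ (one ℚᵘ.+ n′) ℤ.* ℚᵘ.↧ 1+n
    cross-multiplied = trans (ℤₚ.*-identityʳ (ℤ.+ suc n))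
      (trans (cong (λ z → ℤ.+ 1 ℤ.+ z) (sym (ℤₚ.*-identityʳ (ℤ.+ n)))) (sym (ℤₚ.*-identityʳ _)))

  inv-*-fromℕ : ∀ m → inv (suc m) * fromℕ (suc m) ≡ 1ℚ
  inv-*-fromℕ m = ℚₚ.toℚᵘ-injective (begin
    toℚᵘ (inv (suc m) * fromℕ (suc m))
      ≈⟨ ℚₚ.toℚᵘ-homo-* (inv (suc m)) (fromℕ (suc m)) ⟩
    toℚᵘ (inv (suc m)) ℚᵘ.* toℚᵘ (fromℕ (suc m))
      ≈⟨ ℚᵘₚ.*-cong (ℚₚ.toℚᵘ-fromℚᵘ 1/[1+m]) (ℚₚ.toℚᵘ-fromℚᵘ 1+m) ⟩
    1/[1+m] ℚᵘ.* 1+m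
      ≈⟨ ℚᵘ.*≡* cross-multiplied ⟨
    one
      ≈⟨ ℚₚ.toℚᵘ-fromℚᵘ one ⟨
    toℚᵘ 1ℚ
      ∎)
    where
    open ℚᵘₚ.≃-Reasoning
    1/[1+m] 1+m one : ℚᵘ.ℚᵘ
    1/[1+m] = ℚᵘ.mkℚᵘ (ℤ.+ 1) m
    1+m     = ℚᵘ.mkℚᵘ (ℤ.+ suc m) 0
    one     = ℚᵘ.mkℚᵘ (ℤ.+ 1) 0
    cross-multiplied : ℚᵘ.↥ one ℤ.* ℚᵘ.↧ (1/[1+m] ℚᵘ.* 1+m) ≡ ℚᵘ.↥ (1/[1+m] ℚᵘ.* 1+m) ℤ.* ℚᵘ.↧ one
    cross-multiplied = cong (λ j → ℤ.+ suc j) (trans (ℕₚ.+-identityʳ (m ℕ.* 1)) (cong (ℕ._* 1) (sym (ℕₚ.+-identityʳ m))))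

fromℕ-pos : ∀ n → .{{ℕ.NonZero n}} → 0ℚ ℚ.< fromℕ n
fromℕ-pos (suc n) = fromℕ-suc-pos n

fromℕ-*-inv : ∀ n → .{{ℕ.NonZero n}} → fromℕ n * inv n ≡ 1ℚ
fromℕ-*-inv (suc m) = trans (ℚₚ.*-comm (fromℕ (suc m)) (inv (suc m))) (inv-*-fromℕ m)

fromℕ-+ : ∀ m n → fromℕ (m ℕ.+ n) ≡ fromℕ m + fromℕ n
fromℕ-+ zero    n = trans (sym (ℚₚ.+-identityˡ (fromℕ n))) (cong (_+ fromℕ n) (sym fromℕ-0))
fromℕ-+ (suc m) n = begin
  fromℕ (suc (m ℕ.+ n))         ≡⟨ fromℕ-suc (m ℕ.+ n) ⟩
  1ℚ + fromℕ (m ℕ.+ n)          ≡⟨ cong (1ℚ +_) (fromℕ-+ m n) ⟩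
  1ℚ + (fromℕ m + fromℕ n)      ≡⟨ ℚₚ.+-assoc 1ℚ (fromℕ m) (fromℕ n) ⟨
  1ℚ + fromℕ m + fromℕ n        ≡⟨ cong (_+ fromℕ n) (fromℕ-suc m) ⟨
  fromℕ (suc m) + fromℕ n       ∎
  where open ≡-Reasoning

fromℕ-∸ : ∀ m n → n ℕ.≤ m → fromℕ (m ℕ.∸ n) ≡ fromℕ m - fromℕ n
fromℕ-∸ m n n≤m = begin
  fromℕ (m ℕ.∸ n)                          ≡⟨ add-sub (fromℕ (m ℕ.∸ n)) (fromℕ n) ⟩
  fromℕ (m ℕ.∸ n) + fromℕ n - fromℕ n      ≡⟨ cong (_- fromℕ n) (fromℕ-+ (m ℕ.∸ n) n) ⟨
  fromℕ (m ℕ.∸ n ℕ.+ n) - fromℕ n          ≡⟨ cong (λ j → fromℕ j - fromℕ n) (ℕₚ.m∸n+n≡m n≤m) ⟩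
  fromℕ m - fromℕ n                        ∎
  where
  open ≡-Reasoning
  add-sub : ∀ x y → x ≡ x + y - y
  add-sub = solve-∀ ringℚ

fromℕ-split : ∀ {m n} → m ℕ.≤ n → fromℕ n ≡ fromℕ m + fromℕ (n ℕ.∸ m)
fromℕ-split {m} {n} m≤n = trans (cong fromℕ (sym (ℕₚ.m+[n∸m]≡n m≤n))) (fromℕ-+ m (n ℕ.∸ m))

fromℕ-2+ : ∀ n → fromℕ (suc (suc n)) ≡ 2ℚ + fromℕ n
fromℕ-2+ n = trans (fromℕ-suc (suc n)) (trans (cong (1ℚ +_) (fromℕ-suc n)) (sym (ℚₚ.+-assoc 1ℚ 1ℚ (fromℕ n))))

cong₃ : ∀ {A B C D : Set} (f : A → B → C → D) {a a′ b b′ c c′} →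
        a ≡ a′ → b ≡ b′ → c ≡ c′ → f a b c ≡ f a′ b′ c′
cong₃ f refl refl refl = refl

-- Finite sums

δ : ∀ {n} → Fin n → Fin n → ℚ
δ a b = b2q ⌊ a Finₚ.≟ b ⌋

δ-subst : ∀ {n} (l t : Fin n) (h : Fin n → ℚ) → δ l t * h l ≡ δ l t * h t
δ-subst l t h with l Finₚ.≟ t
... | yes refl = refl
... | no _     = trans (ℚₚ.*-zeroˡ (h l)) (sym (ℚₚ.*-zeroˡ (h t)))

δᶜ : ∀ {n} → Fin n → Fin n → ℚ
δᶜ a b = off a b 1ℚ

off-δᶜ : ∀ {n} (i j : Fin n) x → off i j x ≡ δᶜ i j * x
off-δᶜ i j x with i Finₚ.≟ j
... | yes _ = sym (ℚₚ.*-zeroˡ x)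
... | no _  = sym (ℚₚ.*-identityˡ x)

Σ-cong : ∀ {n} {f g : Fin n → ℚ} → (∀ i → f i ≡ g i) → Σ f ≡ Σ g
Σ-cong {zero}  f≗g = refl
Σ-cong {suc n} f≗g = cong₂ _+_ (f≗g zero) (Σ-cong (f≗g ∘ suc))

Σ-zero : ∀ n → Σ {n} (λ _ → 0ℚ) ≡ 0ℚ
Σ-zero zero    = refl
Σ-zero (suc n) = trans (ℚₚ.+-identityˡ _) (Σ-zero n)

Σ-distrib-+ : ∀ {n} (f g : Fin n → ℚ) → Σ (λ i → f i + g i) ≡ Σ f + Σ g
Σ-distrib-+ {zero}  f g = refl
Σ-distrib-+ {suc n} f g =
  trans (cong (f zero + g zero +_) (Σ-distrib-+ (f ∘ suc) (g ∘ suc))) (interchange (f zero) (g zero) _ _)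
  where
  interchange : ∀ a b c d → a + b + (c + d) ≡ a + c + (b + d)
  interchange = solve-∀ ringℚ

Σ-*ˡ : ∀ {n} c (f : Fin n → ℚ) → Σ (λ i → c * f i) ≡ c * Σ f
Σ-*ˡ {zero}  c f = sym (ℚₚ.*-zeroʳ c)
Σ-*ˡ {suc n} c f =
  trans (cong (c * f zero +_) (Σ-*ˡ c (f ∘ suc))) (sym (ℚₚ.*-distribˡ-+ c (f zero) _))

Σ-*ʳ : ∀ {n} c (f : Fin n → ℚ) → Σ (λ i → f i * c) ≡ Σ f * c
Σ-*ʳ c f = trans (Σ-cong (λ i → ℚₚ.*-comm (f i) c)) (trans (Σ-*ˡ c f) (ℚₚ.*-comm c (Σ f)))

Σ-distrib-sub : ∀ {n} (f g : Fin n → ℚ) → Σ (λ i → f i - g i) ≡ Σ f - Σ g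
Σ-distrib-sub f g = begin
  Σ (λ i → f i - g i)            ≡⟨ Σ-cong (λ i → sub (f i) (g i)) ⟩
  Σ (λ i → f i + - 1ℚ * g i)     ≡⟨ Σ-distrib-+ f (λ i → - 1ℚ * g i) ⟩
  Σ f + Σ (λ i → - 1ℚ * g i)     ≡⟨ cong (Σ f +_) (Σ-*ˡ (- 1ℚ) g) ⟩
  Σ f + - 1ℚ * Σ g               ≡⟨ sub (Σ f) (Σ g) ⟨
  Σ f - Σ g                      ∎
  where
  open ≡-Reasoning
  sub : ∀ a b → a - b ≡ a + - 1ℚ * b
  sub = solve-∀ ringℚ

Σ-distrib-+-sub : ∀ {n} (f g h : Fin n → ℚ) → Σ (λ a → f a + g a - h a) ≡ Σ f + Σ g - Σ h
Σ-distrib-+-sub f g h = trans (Σ-distrib-sub (λ a → f a + g a) h) (cong (_- Σ h) (Σ-distrib-+ f g))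

Σ-lincomb : ∀ {n} (f g h : Fin n → ℚ) x y z →
  Σ (λ a → x * f a - y * g a + z * h a) ≡ x * Σ f - y * Σ g + z * Σ h
Σ-lincomb f g h x y z = trans (Σ-distrib-+ (λ a → x * f a - y * g a) (λ a → z * h a))
  (cong₂ _+_ (trans (Σ-distrib-sub (λ a → x * f a) (λ a → y * g a)) (cong₂ _-_ (Σ-*ˡ x f) (Σ-*ˡ y g)))
             (Σ-*ˡ z h))

Σ-comm : ∀ {m n} (f : Fin m → Fin n → ℚ) → Σ (λ i → Σ (f i)) ≡ Σ (λ j → Σ (λ i → f i j))
Σ-comm {zero}  {n} f = sym (Σ-zero n)
Σ-comm {suc m} {n} f = trans (cong (Σ (f zero) +_) (Σ-comm (f ∘ suc)))
  (sym (Σ-distrib-+ (f zero) (λ j → Σ (λ i → f (suc i) j))))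

Σ-δ : ∀ {n} (i : Fin n) (f : Fin n → ℚ) → Σ (λ l → δ l i * f l) ≡ f i
Σ-δ {suc n} zero f = trans
  (cong₂ _+_ (ℚₚ.*-identityˡ (f zero)) (trans (Σ-cong (λ l → ℚₚ.*-zeroˡ (f (suc l)))) (Σ-zero n)))
  (ℚₚ.+-identityʳ (f zero))
Σ-δ {suc n} (suc i) f = trans
  (cong₂ _+_ (ℚₚ.*-zeroˡ (f zero)) (trans (Σ-cong (λ l → cong (_* f (suc l)) (δ-suc l))) (Σ-δ i (f ∘ suc))))
  (ℚₚ.+-identityˡ (f (suc i)))
  where
  δ-suc : ∀ l → δ (suc l) (suc i) ≡ δ l i
  δ-suc l with l Finₚ.≟ i
  ... | yes _ = refl
  ... | no _  = refl

Σ< : ℕ → (ℕ → ℚ) → ℚ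
Σ< n f = Σ {n} (f ∘ toℕ)

Σ<-cong : ∀ n {f g : ℕ → ℚ} → (∀ x → x < n → f x ≡ g x) → Σ< n f ≡ Σ< n g
Σ<-cong n f≗g = Σ-cong (λ a → f≗g (toℕ a) (Finₚ.toℕ<n a))

Σ<-split : ∀ m n (f : ℕ → ℚ) → Σ< (m ℕ.+ n) f ≡ Σ< m f + Σ< n (λ x → f (m ℕ.+ x))
Σ<-split zero    n f = sym (ℚₚ.+-identityˡ _)
Σ<-split (suc m) n f =
  trans (cong (f 0 +_) (Σ<-split m n (f ∘ suc))) (sym (ℚₚ.+-assoc (f 0) _ _))

Σ<-split-≤ : ∀ {m n} (f : ℕ → ℚ) → m ℕ.≤ n → Σ< n f ≡ Σ< m f + Σ< (n ℕ.∸ m) (λ x → f (m ℕ.+ x))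
Σ<-split-≤ {m} {n} f m≤n =
  subst (λ l → Σ< l f ≡ Σ< m f + Σ< (n ℕ.∸ m) (λ x → f (m ℕ.+ x))) (ℕₚ.m+[n∸m]≡n m≤n) (Σ<-split m (n ℕ.∸ m) f)

Σ<-last : ∀ n (f : ℕ → ℚ) → Σ< (suc n) f ≡ Σ< n f + f n
Σ<-last zero    f = trans (ℚₚ.+-identityʳ (f 0)) (sym (ℚₚ.+-identityˡ (f 0)))
Σ<-last (suc n) f =
  trans (cong (f 0 +_) (Σ<-last n (f ∘ suc))) (sym (ℚₚ.+-assoc (f 0) _ _))

Σ<-const : ∀ n c → Σ< n (λ _ → c) ≡ fromℕ n * c
Σ<-const zero    c = sym (trans (cong (_* c) fromℕ-0) (ℚₚ.*-zeroˡ c))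
Σ<-const (suc n) c = begin
  c + Σ< n (λ _ → c)      ≡⟨ cong (c +_) (Σ<-const n c) ⟩
  c + fromℕ n * c         ≡⟨ step c (fromℕ n) ⟩
  (1ℚ + fromℕ n) * c      ≡⟨ cong (_* c) (fromℕ-suc n) ⟨
  fromℕ (suc n) * c       ∎
  where
  open ≡-Reasoning
  step : ∀ a m → a + m * a ≡ (1ℚ + m) * a
  step = solve-∀ ringℚ

Σ<-id : ∀ n → Σ< n fromℕ ≡ fromℕ n * (fromℕ n - 1ℚ) * ½
Σ<-id zero    = cong (λ z → z * (z - 1ℚ) * ½) (sym fromℕ-0)
Σ<-id (suc n) = begin
  Σ< (suc n) fromℕ                                ≡⟨ Σ<-last n fromℕ ⟩
  Σ< n fromℕ + fromℕ n                            ≡⟨ cong (_+ fromℕ n) (Σ<-id n) ⟩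
  fromℕ n * (fromℕ n - 1ℚ) * ½ + fromℕ n          ≡⟨ step (fromℕ n) ⟩
  (1ℚ + fromℕ n) * (1ℚ + fromℕ n - 1ℚ) * ½        ≡⟨ cong (λ z → z * (z - 1ℚ) * ½) (fromℕ-suc n) ⟨
  fromℕ (suc n) * (fromℕ (suc n) - 1ℚ) * ½        ∎
  where
  open ≡-Reasoning
  step : ∀ m → m * (m - 1ℚ) * ½ + m ≡ (1ℚ + m) * (1ℚ + m - 1ℚ) * ½
  step = solve-∀ ringℚ

Σ<-sq : ∀ n → Σ< n (λ x → fromℕ x * fromℕ x) ≡ fromℕ n * (fromℕ n - 1ℚ) * (2ℚ * fromℕ n - 1ℚ) * ⅙
Σ<-sq zero    = cong (λ z → z * (z - 1ℚ) * (2ℚ * z - 1ℚ) * ⅙) (sym fromℕ-0)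
Σ<-sq (suc n) = begin
  Σ< (suc n) sq                                     ≡⟨ Σ<-last n sq ⟩
  Σ< n sq + sq n                                    ≡⟨ cong (_+ sq n) (Σ<-sq n) ⟩
  cubic (fromℕ n) + fromℕ n * fromℕ n               ≡⟨ step (fromℕ n) ⟩
  cubic (1ℚ + fromℕ n)                              ≡⟨ cong cubic (fromℕ-suc n) ⟨
  cubic (fromℕ (suc n))                             ∎
  where
  open ≡-Reasoning
  sq : ℕ → ℚ
  sq x = fromℕ x * fromℕ x
  cubic : ℚ → ℚ
  cubic m = m * (m - 1ℚ) * (2ℚ * m - 1ℚ) * ⅙
  step : ∀ m → m * (m - 1ℚ) * (2ℚ * m - 1ℚ) * ⅙ + m * m ≡ (1ℚ + m) * (1ℚ + m - 1ℚ) * (2ℚ * (1ℚ + m) - 1ℚ) * ⅙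
  step = solve-∀ ringℚ

Σ<-quadratic : ∀ m (f : ℕ → ℚ) a b c → (∀ j → j < m → f j ≡ a + b * fromℕ j + c * (fromℕ j * fromℕ j)) →
  Σ< m f ≡ a * fromℕ m + b * (fromℕ m * (fromℕ m - 1ℚ) * ½) + c * (fromℕ m * (fromℕ m - 1ℚ) * (2ℚ * fromℕ m - 1ℚ) * ⅙)
Σ<-quadratic m f a b c f≡ = begin
  Σ< m f
    ≡⟨ Σ<-cong m f≡ ⟩
  Σ< m (λ j → a + b * fromℕ j + c * sq j)
    ≡⟨ Σ-distrib-+ {m} _ _ ⟩
  Σ< m (λ j → a + b * fromℕ j) + Σ< m (λ j → c * sq j)
    ≡⟨ cong₂ _+_ (Σ-distrib-+ {m} _ _) (Σ-*ˡ {m} c _) ⟩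
  Σ< m (λ _ → a) + Σ< m (λ j → b * fromℕ j) + c * Σ< m sq
    ≡⟨ cong₂ (λ x y → x + y + c * Σ< m sq) (Σ<-const m a) (Σ-*ˡ {m} b _) ⟩
  fromℕ m * a + b * Σ< m fromℕ + c * Σ< m sq
    ≡⟨ cong₂ (λ x y → fromℕ m * a + b * x + c * y) (Σ<-id m) (Σ<-sq m) ⟩
  fromℕ m * a + b * (fromℕ m * (fromℕ m - 1ℚ) * ½)
    + c * (fromℕ m * (fromℕ m - 1ℚ) * (2ℚ * fromℕ m - 1ℚ) * ⅙) ≡⟨ cong (λ x → x + _ + _) (ℚₚ.*-comm (fromℕ m) a) ⟩
  a * fromℕ m + b * (fromℕ m * (fromℕ m - 1ℚ) * ½)
    + c * (fromℕ m * (fromℕ m - 1ℚ) * (2ℚ * fromℕ m - 1ℚ) * ⅙) ∎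
  where
  open ≡-Reasoning
  sq : ℕ → ℚ
  sq x = fromℕ x * fromℕ x

≡ᵇ-sym : ∀ m n → (m ≡ᵇ n) ≡ (n ≡ᵇ m)
≡ᵇ-sym zero    zero    = refl
≡ᵇ-sym zero    (suc n) = refl
≡ᵇ-sym (suc m) zero    = refl
≡ᵇ-sym (suc m) (suc n) = ≡ᵇ-sym m n

Σ<-indicator : ∀ n c (f : ℕ → ℚ) → c < n → Σ< n (λ y → b2q (c ≡ᵇ y) * f y) ≡ f c
Σ<-indicator (suc n) zero    f _ = trans
  (cong₂ _+_ (ℚₚ.*-identityˡ (f 0)) (trans (Σ<-cong n (λ x _ → ℚₚ.*-zeroˡ (f (suc x)))) (Σ-zero n)))
  (ℚₚ.+-identityʳ (f 0))
Σ<-indicator (suc n) (suc c) f (s≤s c<n) =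
  trans (cong₂ _+_ (ℚₚ.*-zeroˡ (f 0)) (Σ<-indicator n c (f ∘ suc) c<n)) (ℚₚ.+-identityˡ (f (suc c)))

Σ<-indicator′ : ∀ n c (f : ℕ → ℚ) → c < n → Σ< n (λ y → b2q (y ≡ᵇ c) * f y) ≡ f c
Σ<-indicator′ n c f c<n =
  trans (Σ<-cong n (λ y _ → cong (λ b → b2q b * f y) (≡ᵇ-sym y c))) (Σ<-indicator n c f c<n)

Σ<-indicator-out : ∀ n c (f : ℕ → ℚ) → n ℕ.≤ c → Σ< n (λ y → b2q (c ≡ᵇ y) * f y) ≡ 0ℚ
Σ<-indicator-out zero    c       f _ = refl
Σ<-indicator-out (suc n) (suc c) f (s≤s n≤c) =
  trans (cong₂ _+_ (ℚₚ.*-zeroˡ (f 0)) (Σ<-indicator-out n c (f ∘ suc) n≤c)) (ℚₚ.+-identityˡ 0ℚ)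

Σ-pair : ∀ {n} (u w : Fin n) (f : Fin n → ℚ) → Σ (λ a → (δ a u + δ a w) * f a) ≡ f u + f w
Σ-pair u w f = trans (Σ-cong (λ a → ℚₚ.*-distribʳ-+ (f a) (δ a u) (δ a w)))
                     (trans (Σ-distrib-+ (λ a → δ a u * f a) (λ a → δ a w * f a)) (cong₂ _+_ (Σ-δ u f) (Σ-δ w f)))

Σ-bump : ∀ {n} (u w : Fin n) (d f : Fin n → ℚ) →
  Σ (λ a → (d a + (δ a u + δ a w)) * f a) ≡ Σ (λ a → d a * f a) + (f u + f w)
Σ-bump u w d f = trans (Σ-cong (λ a → ℚₚ.*-distribʳ-+ (f a) (d a) (δ a u + δ a w)))
                       (trans (Σ-distrib-+ (λ a → d a * f a) _) (cong (Σ (λ a → d a * f a) +_) (Σ-pair u w f)))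

-- Lagrange's identity, weighted by x.
Σ²-sq-diff : ∀ {n} (x y : Fin n → ℚ) →
  Σ (λ b → Σ (λ a → x a * x b * ((y a - y b) * (y a - y b))))
    ≡ 2ℚ * Σ x * Σ (λ a → x a * (y a * y a)) - 2ℚ * (Σ (λ a → x a * y a) * Σ (λ a → x a * y a))
Σ²-sq-diff {n} x y = begin
  Σ (λ b → Σ (λ a → x a * x b * ((y a - y b) * (y a - y b))))
    ≡⟨ Σ-cong inner ⟩
  Σ (λ b → S₂ * x b - S₁ * (2ℚ * (x b * y b)) + X * (x b * (y b * y b)))
    ≡⟨ Σ-lincomb x (λ b → 2ℚ * (x b * y b)) (λ b → x b * (y b * y b)) S₂ S₁ X ⟩
  S₂ * X - S₁ * Σ (λ b → 2ℚ * (x b * y b)) + X * S₂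
    ≡⟨ cong (λ z → S₂ * X - S₁ * z + X * S₂) (Σ-*ˡ 2ℚ (λ b → x b * y b)) ⟩
  S₂ * X - S₁ * (2ℚ * S₁) + X * S₂
    ≡⟨ collect X S₁ S₂ ⟩
  2ℚ * X * S₂ - 2ℚ * (S₁ * S₁)
    ∎
  where
  open ≡-Reasoning
  X S₁ S₂ : ℚ
  X = Σ x
  S₁ = Σ (λ a → x a * y a)
  S₂ = Σ (λ a → x a * (y a * y a))
  collect : ∀ X s₁ s₂ → s₂ * X - s₁ * (2ℚ * s₁) + X * s₂ ≡ 2ℚ * X * s₂ - 2ℚ * (s₁ * s₁)
  collect = solve-∀ ringℚ
  expand : ∀ xa xb ya yb → xa * xb * ((ya - yb) * (ya - yb)) ≡ xb * (xa * (ya * ya)) - (2ℚ * (xb * yb)) * (xa * ya) + (xb * (yb * yb)) * xa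
  expand = solve-∀ ringℚ
  reorder : ∀ p q r s₂ s₁ X → p * s₂ - q * s₁ + r * X ≡ s₂ * p - s₁ * q + X * r
  reorder = solve-∀ ringℚ
  inner : ∀ b → Σ (λ a → x a * x b * ((y a - y b) * (y a - y b))) ≡ S₂ * x b - S₁ * (2ℚ * (x b * y b)) + X * (x b * (y b * y b))
  inner b = trans (Σ-cong (λ a → expand (x a) (x b) (y a) (y b)))
    (trans (Σ-lincomb (λ a → x a * (y a * y a)) (λ a → x a * y a) x (x b) (2ℚ * (x b * y b)) (x b * (y b * y b)))
           (reorder (x b) (2ℚ * (x b * y b)) (x b * (y b * y b)) S₂ S₁ X))

-- Kemeny's constant and effective resistances

fromℕ-b2n : ∀ b → fromℕ (b2n b) ≡ b2q b
fromℕ-b2n true  = fromℕ-1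
fromℕ-b2n false = fromℕ-0

fromℕ-sumℕ : ∀ {n} (f : Fin n → ℕ) → fromℕ (sumℕ f) ≡ Σ (fromℕ ∘ f)
fromℕ-sumℕ {zero}  f = fromℕ-0
fromℕ-sumℕ {suc n} f = trans (fromℕ-+ (f zero) _) (cong (fromℕ (f zero) +_) (fromℕ-sumℕ (f ∘ suc)))

≤-sumℕ : ∀ {n} (f : Fin n → ℕ) l → f l ℕ.≤ sumℕ f
≤-sumℕ f zero    = ℕₚ.m≤m+n (f zero) _
≤-sumℕ f (suc l) = ℕₚ.≤-trans (≤-sumℕ (f ∘ suc) l) (ℕₚ.m≤n+m _ (f zero))

Symmetric : ∀ {n} → Graph n → Set
Symmetric G = ∀ a b → G a b ≡ G b a

degℚ : ∀ {n} → Graph n → Fin n → ℚ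
degℚ G a = fromℕ (deg G a)

degℚ≡Σ : ∀ {n} (G : Graph n) a → degℚ G a ≡ Σ (λ b → b2q (G a b))
degℚ≡Σ G a = trans (fromℕ-sumℕ (λ b → b2n (G a b))) (Σ-cong (λ b → fromℕ-b2n (G a b)))

twiceEdges≡Σdeg : ∀ {n} (G : Graph n) → fromℕ (twiceEdges G) ≡ Σ (degℚ G)
twiceEdges≡Σdeg G = fromℕ-sumℕ (deg G)

degℚ-*-P : ∀ {n} (G : Graph n) a l → degℚ G a * P G a l ≡ b2q (G a l)
degℚ-*-P G a l with G a l in Gal
... | false = trans (cong (degℚ G a *_) (ℚₚ.*-zeroˡ (inv (deg G a)))) (ℚₚ.*-zeroʳ (degℚ G a))
... | true  = trans (cong (degℚ G a *_) (ℚₚ.*-identityˡ (inv (deg G a))))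
                    (fromℕ-*-inv (deg G a) {{ℕ.>-nonZero deg>0}})
  where
  deg>0 : 0 < deg G a
  deg>0 = subst (λ b → b2n b ℕ.≤ deg G a) Gal (≤-sumℕ (λ b → b2n (G a b)) l)

twiceEdges-pos : ∀ {n} (G : Graph n) a b → G a b ≡ true → 0 < twiceEdges G
twiceEdges-pos G a b Gab = ℕₚ.≤-trans (subst (λ x → b2n x ℕ.≤ deg G a) Gab (≤-sumℕ (λ c → b2n (G a c)) b)) (≤-sumℕ (deg G) a)

weightedResistance : ∀ {n} → Graph n → (Fin n → Fin n → ℚ) → ℚ
weightedResistance G R = Σ (λ b → Σ (λ a → degℚ G a * degℚ G b * R a b))

-- L R = v 𝟙ᵀ - 2 I for the Laplacian L of G.  For a connected graph this characterises the
-- matrix of effective resistances (for a tree, the distance matrix); v is then determined by R.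
record IsResistance {n} (G : Graph n) (R : Fin n → Fin n → ℚ) : Set where
  field
    symmetric     : ∀ a b → R a b ≡ R b a
    zero-diagonal : ∀ a → R a a ≡ 0ℚ
    potential     : Fin n → ℚ
    laplacian     : ∀ l x → Σ (λ a → b2q (G l a) * (R l x - R a x)) ≡ potential l - 2ℚ * δ l x

module KemenyWeights {n} {G : Graph n} (G-sym : Symmetric G)
                     {R : Fin n → Fin n → ℚ} (isR : IsResistance G R) (i : Fin n) where
  open IsResistance isR
  open ≡-Reasoning

  private
    d : Fin n → ℚ
    d = degℚ G

    A : Fin n → Fin n → ℚ
    A a b = b2q (G a b)

  Q : Fin n → Fin n → ℚ
  Q a b = R i b + R a b - R i a

  -- Σ_a weight a b = m_ib π_b for b ≢ i, for every solution m of the first-step equations.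
  weight : Fin n → Fin n → ℚ
  weight a b = π G b * (d a * Q a b) * ½

  Q-diag : ∀ b → Q b b ≡ 0ℚ
  Q-diag b = trans (cong (λ z → R i b + z - R i b) (zero-diagonal b)) (cancel (R i b))
    where
    cancel : ∀ x → x + 0ℚ - x ≡ 0ℚ
    cancel = solve-∀ ringℚ

  δᶜ-weight : ∀ a b → δᶜ a b * weight a b ≡ weight a b
  δᶜ-weight a b with a Finₚ.≟ b
  ... | no _     = ℚₚ.*-identityˡ (weight a b)
  ... | yes refl = trans (ℚₚ.*-zeroˡ (weight a a)) (sym (begin
    π G a * (d a * Q a a) * ½   ≡⟨ cong (λ z → π G a * (d a * z) * ½) (Q-diag a) ⟩
    π G a * (d a * 0ℚ) * ½      ≡⟨ vanish (π G a) (d a) ⟩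
    0ℚ                          ∎))
    where
    vanish : ∀ x y → x * (y * 0ℚ) * ½ ≡ 0ℚ
    vanish = solve-∀ ringℚ

  δᶜ-weight-P : ∀ a b l → δᶜ a b * (weight a b * P G a l) ≡ (π G b * ½) * (A l a * Q a b)
  δᶜ-weight-P a b l with a Finₚ.≟ b
  ... | yes refl = begin
    0ℚ * (weight a a * P G a l)       ≡⟨ ℚₚ.*-zeroˡ (weight a a * P G a l) ⟩
    0ℚ                                ≡⟨ vanish (π G a * ½) (A l a) ⟨
    (π G a * ½) * (A l a * 0ℚ)        ≡⟨ cong (λ z → (π G a * ½) * (A l a * z)) (Q-diag a) ⟨
    (π G a * ½) * (A l a * Q a a)     ∎
    where
    vanish : ∀ x y → x * (y * 0ℚ) ≡ 0ℚ
    vanish = solve-∀ ringℚ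
  ... | no _ = begin
    1ℚ * (weight a b * P G a l)               ≡⟨ regroup (π G b) (d a) (Q a b) (P G a l) ⟩
    (π G b * ½) * ((d a * P G a l) * Q a b)   ≡⟨ cong (λ z → (π G b * ½) * (z * Q a b)) (degℚ-*-P G a l) ⟩
    (π G b * ½) * (A a l * Q a b)             ≡⟨ cong (λ z → (π G b * ½) * (b2q z * Q a b)) (G-sym a l) ⟩
    (π G b * ½) * (A l a * Q a b)             ∎
    where
    regroup : ∀ p x q y → 1ℚ * (p * (x * q) * ½ * y) ≡ (p * ½) * ((x * y) * q)
    regroup = solve-∀ ringℚ

  laplacian-Q : ∀ l b → Σ (λ a → A l a * (Q l b - Q a b)) ≡ 2ℚ * δ l i - 2ℚ * δ l b
  laplacian-Q l b = begin
    Σ (λ a → A l a * (Q l b - Q a b))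
      ≡⟨ Σ-cong split ⟩
    Σ (λ a → A l a * (R l b - R a b) - A l a * (R l i - R a i))
      ≡⟨ Σ-distrib-sub {n} _ _ ⟩
    Σ (λ a → A l a * (R l b - R a b)) - Σ (λ a → A l a * (R l i - R a i))
      ≡⟨ cong₂ _-_ (laplacian l b) (laplacian l i) ⟩
    (potential l - 2ℚ * δ l b) - (potential l - 2ℚ * δ l i)
      ≡⟨ simplify (potential l) (δ l b) (δ l i) ⟩
    2ℚ * δ l i - 2ℚ * δ l b
      ∎
    where
    simplify : ∀ v x y → (v - 2ℚ * x) - (v - 2ℚ * y) ≡ 2ℚ * y - 2ℚ * x
    simplify = solve-∀ ringℚ
    expand : ∀ g rib rlb rab rli rai → g * ((rib + rlb - rli) - (rib + rab - rai)) ≡ g * (rlb - rab) - g * (rli - rai)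
    expand = solve-∀ ringℚ
    split : ∀ a → A l a * (Q l b - Q a b) ≡ A l a * (R l b - R a b) - A l a * (R l i - R a i)
    split a = trans (cong₂ (λ x y → A l a * ((R i b + R l b - x) - (R i b + R a b - y))) (symmetric i l) (symmetric i a))
                    (expand (A l a) (R i b) (R l b) (R a b) (R l i) (R a i))

  Σ-A-Q : ∀ l b → Σ (λ a → A l a * Q a b) ≡ d l * Q l b - (2ℚ * δ l i - 2ℚ * δ l b)
  Σ-A-Q l b = begin
    Σ (λ a → A l a * Q a b)
      ≡⟨ Σ-cong (λ a → rearrange (A l a) (Q l b) (Q a b)) ⟩
    Σ (λ a → A l a * Q l b - A l a * (Q l b - Q a b))
      ≡⟨ Σ-distrib-sub {n} _ _ ⟩
    Σ (λ a → A l a * Q l b) - Σ (λ a → A l a * (Q l b - Q a b))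
      ≡⟨ cong₂ _-_ Σ-A (laplacian-Q l b) ⟩
    d l * Q l b - (2ℚ * δ l i - 2ℚ * δ l b) ∎
    where
    rearrange : ∀ g x y → g * y ≡ g * x - g * (x - y)
    rearrange = solve-∀ ringℚ
    Σ-A : Σ (λ a → A l a * Q l b) ≡ d l * Q l b
    Σ-A = trans (Σ-*ʳ (Q l b) (A l)) (cong (_* Q l b) (sym (degℚ≡Σ G l)))

  -- The weights of a fixed target b satisfy the adjoint of the first-step equations.
  weight-adjoint : ∀ l b → l ≢ b → Σ (λ a → δᶜ a b * (weight a b * P G a l)) ≡ weight l b - δ l i * π G b
  weight-adjoint l b l≢b = begin
    Σ (λ a → δᶜ a b * (weight a b * P G a l))
      ≡⟨ Σ-cong (λ a → δᶜ-weight-P a b l) ⟩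
    Σ (λ a → (π G b * ½) * (A l a * Q a b))
      ≡⟨ Σ-*ˡ {n} (π G b * ½) _ ⟩
    (π G b * ½) * Σ (λ a → A l a * Q a b)
      ≡⟨ cong ((π G b * ½) *_) (Σ-A-Q l b) ⟩
    (π G b * ½) * (d l * Q l b - (2ℚ * δ l i - 2ℚ * δ l b))
      ≡⟨ cong (λ z → (π G b * ½) * (d l * Q l b - (2ℚ * δ l i - 2ℚ * z))) δlb≡0 ⟩
    (π G b * ½) * (d l * Q l b - (2ℚ * δ l i - 2ℚ * 0ℚ))
      ≡⟨ simplify (π G b) (d l * Q l b) (δ l i) ⟩
    weight l b - δ l i * π G b ∎
    where
    simplify : ∀ p y c → (p * ½) * (y - (2ℚ * c - 2ℚ * 0ℚ)) ≡ p * y * ½ - c * p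
    simplify = solve-∀ ringℚ
    δlb≡0 : δ l b ≡ 0ℚ
    δlb≡0 with l Finₚ.≟ b
    ... | yes l≡b = ⊥-elim (l≢b l≡b)
    ... | no _    = refl

  Σ-weight : Σ (λ b → Σ (λ a → weight a b)) ≡ (inv (twiceEdges G) * ½) * weightedResistance G R
  Σ-weight = begin
    Σ (λ b → Σ (λ a → weight a b))
      ≡⟨ Σ-cong (λ b → trans (Σ-cong (expand b)) (Σ-*ˡ {n} c _)) ⟩
    Σ (λ b → c * Σ (λ a → x a b + y a b - z a b))
      ≡⟨ Σ-*ˡ {n} c _ ⟩
    c * Σ (λ b → Σ (λ a → x a b + y a b - z a b))
      ≡⟨ cong (c *_) (Σ-cong (λ b → Σ-distrib-+-sub (x ⁻ b) (y ⁻ b) (z ⁻ b))) ⟩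
    c * Σ (λ b → Σ (x ⁻ b) + Σ (y ⁻ b) - Σ (z ⁻ b))
      ≡⟨ cong (c *_) (Σ-distrib-+-sub (λ b → Σ (x ⁻ b)) (λ b → Σ (y ⁻ b)) (λ b → Σ (z ⁻ b))) ⟩
    c * (Σx + weightedResistance G R - Σz)
      ≡⟨ cong (λ s → c * (s + weightedResistance G R - Σz)) Σx≡Σz ⟩
    c * (Σz + weightedResistance G R - Σz)
      ≡⟨ cong (c *_) (cancel Σz (weightedResistance G R)) ⟩
    c * weightedResistance G R ∎
    where
    c : ℚ
    c = inv (twiceEdges G) * ½
    x y z : Fin n → Fin n → ℚ
    x a b = d a * d b * R i b
    y a b = d a * d b * R a b
    z a b = d a * d b * R i a
    _⁻_ : (Fin n → Fin n → ℚ) → Fin n → Fin n → ℚ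
    (f ⁻ b) a = f a b
    Σx Σz : ℚ
    Σx = Σ (λ b → Σ (x ⁻ b))
    Σz = Σ (λ b → Σ (z ⁻ b))
    Σx≡Σz : Σx ≡ Σz
    Σx≡Σz = trans (Σ-comm (λ b a → x a b)) (Σ-cong (λ b → Σ-cong (λ a → cong (_* R i a) (ℚₚ.*-comm (d b) (d a)))))
    distribute : ∀ ι db da rib rab ria → db * ι * (da * (rib + rab - ria)) * ½ ≡ (ι * ½) * (da * db * rib + da * db * rab - da * db * ria)
    distribute = solve-∀ ringℚ
    expand : ∀ b a → weight a b ≡ c * (x a b + y a b - z a b)
    expand b a = trans (cong (λ p → p * (d a * Q a b) * ½) (π-fromℕ G b))
                       (distribute (inv (twiceEdges G)) (d b) (d a) (R i b) (R a b) (R i a))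
    cancel : ∀ s w → s + w - s ≡ w
    cancel = solve-∀ ringℚ

  module _ {m : Fin n → Fin n → ℚ} (mfpt : IsMFPT G m) where

    private
      Y : Fin n → ℚ
      Y b = Σ (λ a → δᶜ a b * (weight a b * m a b))

      first-step : ∀ b a → δᶜ a b * (weight a b * m a b)
                        ≡ δᶜ a b * weight a b + δᶜ a b * (weight a b * Σ (λ l → δᶜ l b * (P G a l * m l b)))
      first-step b a with a Finₚ.≟ b in a≟b
      ... | yes _ = vanish (weight a b * m a b) (weight a b) (weight a b * Σ (λ l → δᶜ l b * (P G a l * m l b)))
        where
        vanish : ∀ x y z → 0ℚ * x ≡ 0ℚ * y + 0ℚ * z
        vanish = solve-∀ ringℚ
      ... | no _ = begin
        1ℚ * (weight a b * m a b)   ≡⟨ cong (λ t → 1ℚ * (weight a b * t)) (mfpt a b (cong ⌊_⌋ a≟b)) ⟩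
        1ℚ * (weight a b * (1ℚ + Σ (λ l → off l b (P G a l * m l b))))
                                    ≡⟨ cong (λ t → 1ℚ * (weight a b * (1ℚ + t))) (Σ-cong (λ l → off-δᶜ l b _)) ⟩
        1ℚ * (weight a b * (1ℚ + Σ (λ l → δᶜ l b * (P G a l * m l b))))
                                    ≡⟨ distrib (weight a b) _ ⟩
        _                           ∎
        where
        distrib : ∀ w t → 1ℚ * (w * (1ℚ + t)) ≡ 1ℚ * w + 1ℚ * (w * t)
        distrib = solve-∀ ringℚ

      exchange : ∀ b → Σ (λ a → δᶜ a b * (weight a b * Σ (λ l → δᶜ l b * (P G a l * m l b))))
                     ≡ Σ (λ l → δᶜ l b * (m l b * Σ (λ a → δᶜ a b * (weight a b * P G a l))))
      exchange b = begin
        Σ (λ a → δᶜ a b * (weight a b * Σ (λ l → δᶜ l b * (P G a l * m l b))))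
          ≡⟨ Σ-cong (λ a → trans (sym (ℚₚ.*-assoc (δᶜ a b) _ _)) (sym (Σ-*ˡ {n} (δᶜ a b * weight a b) _))) ⟩
        Σ (λ a → Σ (λ l → (δᶜ a b * weight a b) * (δᶜ l b * (P G a l * m l b))))
          ≡⟨ Σ-comm {n} {n} _ ⟩
        Σ (λ l → Σ (λ a → (δᶜ a b * weight a b) * (δᶜ l b * (P G a l * m l b))))
          ≡⟨ Σ-cong (λ l → trans (Σ-cong (λ a → regroup (δᶜ a b) (weight a b) (δᶜ l b) (P G a l) (m l b)))
                                 (trans (Σ-*ˡ {n} (δᶜ l b * m l b) _) (ℚₚ.*-assoc (δᶜ l b) (m l b) _))) ⟩
        Σ (λ l → δᶜ l b * (m l b * Σ (λ a → δᶜ a b * (weight a b * P G a l))))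
          ∎
        where
        regroup : ∀ x y z w u → (x * y) * (z * (w * u)) ≡ (z * u) * (x * (y * w))
        regroup = solve-∀ ringℚ

      adjoint-step : ∀ b → Σ (λ l → δᶜ l b * (m l b * Σ (λ a → δᶜ a b * (weight a b * P G a l))))
                        ≡ Y b - δᶜ i b * (m i b * π G b)
      adjoint-step b = trans (Σ-cong step)
        (trans (Σ-distrib-sub (λ l → δᶜ l b * (weight l b * m l b)) (λ l → δ l i * (δᶜ l b * (m l b * π G b))))
               (cong (λ t → Y b - t) (Σ-δ i (λ l → δᶜ l b * (m l b * π G b)))))
        where
        step : ∀ l → δᶜ l b * (m l b * Σ (λ a → δᶜ a b * (weight a b * P G a l)))
                   ≡ δᶜ l b * (weight l b * m l b) - δ l i * (δᶜ l b * (m l b * π G b))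
        step l with l Finₚ.≟ b
        ... | yes _   = vanish (m l b * Σ (λ a → δᶜ a b * (weight a b * P G a l))) (weight l b * m l b) (δ l i) (m l b * π G b)
          where
          vanish : ∀ x y z w → 0ℚ * x ≡ 0ℚ * y - z * (0ℚ * w)
          vanish = solve-∀ ringℚ
        ... | no l≢b = trans (cong (λ t → 1ℚ * (m l b * t)) (weight-adjoint l b l≢b))
                             (rearrange (m l b) (weight l b) (δ l i) (π G b))
          where
          rearrange : ∀ x y z w → 1ℚ * (x * (y - z * w)) ≡ 1ℚ * (y * x) - z * (1ℚ * (x * w))
          rearrange = solve-∀ ringℚ

    -- Expanding Y b by the first-step equations and the adjoint equations gives Λ + Y b - m_ib π_b.
    mfpt-weight : ∀ b → δᶜ i b * (m i b * π G b) ≡ Σ (λ a → δᶜ a b * weight a b)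
    mfpt-weight b = cancel (Y b) Λ (δᶜ i b * (m i b * π G b))
      (trans (Σ-cong (first-step b)) (trans (Σ-distrib-+ {n} _ _) (cong (Λ +_) (trans (exchange b) (adjoint-step b)))))
      where
      Λ : ℚ
      Λ = Σ (λ a → δᶜ a b * weight a b)
      solution : ∀ y a c → c ≡ (y - (a + (y - c))) + a
      solution = solve-∀ ringℚ
      cancel : ∀ y a c → y ≡ a + (y - c) → c ≡ a
      cancel y a c eq = trans (solution y a c) (trans (cong (λ z → (y - z) + a) (sym eq)) (trivial y a))
        where
        trivial : ∀ y a → (y - y) + a ≡ a
        trivial = solve-∀ ringℚ

    kemenyAt≡Σ-weight : kemenyAt G m i ≡ Σ (λ b → Σ (λ a → weight a b))
    kemenyAt≡Σ-weight = trans (Σ-cong (λ b → off-δᶜ i b (m i b * π G b)))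
                      (trans (Σ-cong mfpt-weight) (Σ-cong (λ b → Σ-cong (λ a → δᶜ-weight a b))))

kemeny-resistance : ∀ {n} {G : Graph n} {R m} → .{{ℕ.NonZero (twiceEdges G)}} →
  Symmetric G → IsResistance G R → IsMFPT G m → ∀ i →
  fromℕ (twiceEdges G) * kemenyAt G m i ≡ ½ * weightedResistance G R
kemeny-resistance {G = G} {R} {m} G-sym isR mfpt i = begin
  E * kemenyAt G m i                        ≡⟨ cong (E *_) (trans (kemenyAt≡Σ-weight mfpt) Σ-weight) ⟩
  E * ((inv (twiceEdges G) * ½) * W)        ≡⟨ regroup E (inv (twiceEdges G)) W ⟩
  (E * inv (twiceEdges G)) * (½ * W)        ≡⟨ cong (_* (½ * W)) (fromℕ-*-inv (twiceEdges G)) ⟩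
  1ℚ * (½ * W)                              ≡⟨ ℚₚ.*-identityˡ _ ⟩
  ½ * W                                     ∎
  where
  open KemenyWeights G-sym isR i
  open ≡-Reasoning
  E W : ℚ
  E = fromℕ (twiceEdges G)
  W = weightedResistance G R
  regroup : ∀ e ι w → e * ((ι * ½) * w) ≡ (e * ι) * (½ * w)
  regroup = solve-∀ ringℚ

-- Adding an edge

b2q-∨ : ∀ x y → (x ∧ y) ≡ false → b2q (x ∨ y) ≡ b2q x + b2q y
b2q-∨ false y     _  = sym (ℚₚ.+-identityˡ (b2q y))
b2q-∨ true  false _  = refl

b2q-∧ : ∀ x y → b2q (x ∧ y) ≡ b2q x * b2q y
b2q-∧ false y = sym (ℚₚ.*-zeroˡ (b2q y))
b2q-∧ true  y = sym (ℚₚ.*-identityˡ (b2q y))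

module AddEdge {n} {G : Graph n} (G-sym : Symmetric G) {u w : Fin n} (u≢w : u ≢ w) (Guw : G u w ≡ false) where

  G′ : Graph n
  G′ = addEdge G u w

  private
    is : Fin n → Fin n → Bool
    is a b = ⌊ a Finₚ.≟ b ⌋

    missing : ∀ {x y} → G x y ≡ false → ∀ l a → (G l a ∧ (is l x ∧ is a y)) ≡ false
    missing {x} {y} Gxy l a with l Finₚ.≟ x | a Finₚ.≟ y
    ... | yes refl | yes refl = cong (_∧ true) Gxy
    ... | yes _    | no _     = Boolₚ.∧-zeroʳ (G l a)
    ... | no _     | _        = Boolₚ.∧-zeroʳ (G l a)

    new-edge : ∀ l a → (G l a ∧ ((is l u ∧ is a w) ∨ (is l w ∧ is a u))) ≡ false
    new-edge l a = trans (Boolₚ.∧-distribˡ-∨ (G l a) _ _)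
      (cong₂ _∨_ (missing Guw l a) (missing (trans (G-sym w u) Guw) l a))

    endpoints : ∀ l a → ((is l u ∧ is a w) ∧ (is l w ∧ is a u)) ≡ false
    endpoints l a with l Finₚ.≟ u | l Finₚ.≟ w
    ... | yes refl | yes refl = ⊥-elim (u≢w refl)
    ... | yes _    | no _     = Boolₚ.∧-zeroʳ (is a w)
    ... | no _     | _        = refl

  b2q-addEdge : ∀ l a → b2q (G′ l a) ≡ b2q (G l a) + δ l u * δ a w + δ l w * δ a u
  b2q-addEdge l a = begin
    b2q (G l a ∨ (is l u ∧ is a w) ∨ (is l w ∧ is a u))
      ≡⟨ b2q-∨ (G l a) ((is l u ∧ is a w) ∨ (is l w ∧ is a u)) (new-edge l a) ⟩
    b2q (G l a) + b2q ((is l u ∧ is a w) ∨ (is l w ∧ is a u))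
      ≡⟨ cong (b2q (G l a) +_) (b2q-∨ (is l u ∧ is a w) (is l w ∧ is a u) (endpoints l a)) ⟩
    b2q (G l a) + (b2q (is l u ∧ is a w) + b2q (is l w ∧ is a u))
      ≡⟨ cong₂ (λ x y → b2q (G l a) + (x + y)) (b2q-∧ (is l u) (is a w)) (b2q-∧ (is l w) (is a u)) ⟩
    b2q (G l a) + (δ l u * δ a w + δ l w * δ a u)
      ≡⟨ ℚₚ.+-assoc (b2q (G l a)) _ _ ⟨
    b2q (G l a) + δ l u * δ a w + δ l w * δ a u
      ∎
    where open ≡-Reasoning

  Σ-addEdge : ∀ l (f : Fin n → ℚ) →
    Σ (λ a → b2q (G′ l a) * f a) ≡ Σ (λ a → b2q (G l a) * f a) + δ l u * f w + δ l w * f u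
  Σ-addEdge l f = begin
    Σ (λ a → b2q (G′ l a) * f a)
      ≡⟨ Σ-cong (λ a → trans (cong (_* f a) (b2q-addEdge l a)) (distrib (b2q (G l a)) (δ l u) (δ a w) (δ l w) (δ a u) (f a))) ⟩
    Σ (λ a → b2q (G l a) * f a + δ l u * (δ a w * f a) + δ l w * (δ a u * f a))
      ≡⟨ trans (Σ-distrib-+ {n} _ _) (cong (_+ _) (Σ-distrib-+ {n} _ _)) ⟩
    Σ (λ a → b2q (G l a) * f a) + Σ (λ a → δ l u * (δ a w * f a)) + Σ (λ a → δ l w * (δ a u * f a))
      ≡⟨ cong₂ (λ x y → Σ (λ a → b2q (G l a) * f a) + x + y) (trans (Σ-*ˡ {n} (δ l u) _) (cong (δ l u *_) (Σ-δ w f)))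
          (trans (Σ-*ˡ {n} (δ l w) _) (cong (δ l w *_) (Σ-δ u f))) ⟩
    Σ (λ a → b2q (G l a) * f a) + δ l u * f w + δ l w * f u
      ∎
    where
    open ≡-Reasoning
    distrib : ∀ g x y z t h → (g + x * y + z * t) * h ≡ g * h + x * (y * h) + z * (t * h)
    distrib = solve-∀ ringℚ

  addEdge-sym : Symmetric G′
  addEdge-sym a b = cong₂ _∨_ (G-sym a b)
    (trans (Boolₚ.∨-comm (is a u ∧ is b w) (is a w ∧ is b u))
           (cong₂ _∨_ (Boolₚ.∧-comm (is a w) (is b u)) (Boolₚ.∧-comm (is a u) (is b w))))

  degℚ-addEdge : ∀ a → degℚ G′ a ≡ degℚ G a + (δ a u + δ a w)
  degℚ-addEdge a = begin
    degℚ G′ a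
      ≡⟨ degℚ≡Σ G′ a ⟩
    Σ (λ b → b2q (G′ a b))
      ≡⟨ Σ-cong (λ b → sym (ℚₚ.*-identityʳ (b2q (G′ a b)))) ⟩
    Σ (λ b → b2q (G′ a b) * 1ℚ)
      ≡⟨ Σ-addEdge a (λ _ → 1ℚ) ⟩
    Σ (λ b → b2q (G a b) * 1ℚ) + δ a u * 1ℚ + δ a w * 1ℚ
      ≡⟨ cong₂ (λ x y → x + δ a u * 1ℚ + y) Σ≡deg (ℚₚ.*-identityʳ (δ a w)) ⟩
    degℚ G a + δ a u * 1ℚ + δ a w
      ≡⟨ cong (λ x → degℚ G a + x + δ a w) (ℚₚ.*-identityʳ (δ a u)) ⟩
    degℚ G a + δ a u + δ a w
      ≡⟨ ℚₚ.+-assoc (degℚ G a) (δ a u) (δ a w) ⟩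
    degℚ G a + (δ a u + δ a w) ∎
    where
    open ≡-Reasoning
    Σ≡deg : Σ (λ b → b2q (G a b) * 1ℚ) ≡ degℚ G a
    Σ≡deg = trans (Σ-cong (λ b → ℚₚ.*-identityʳ (b2q (G a b)))) (sym (degℚ≡Σ G a))

  twiceEdges-addEdge : fromℕ (twiceEdges G′) ≡ fromℕ (twiceEdges G) + 2ℚ
  twiceEdges-addEdge = begin
    fromℕ (twiceEdges G′)
      ≡⟨ twiceEdges≡Σdeg G′ ⟩
    Σ (degℚ G′)
      ≡⟨ Σ-cong degℚ-addEdge ⟩
    Σ (λ a → degℚ G a + (δ a u + δ a w))
      ≡⟨ Σ-distrib-+ (degℚ G) (λ a → δ a u + δ a w) ⟩
    Σ (degℚ G) + Σ (λ a → δ a u + δ a w)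
      ≡⟨ cong₂ _+_ (sym (twiceEdges≡Σdeg G))
                   (trans (Σ-cong (λ a → sym (ℚₚ.*-identityʳ (δ a u + δ a w)))) (Σ-pair u w (λ _ → 1ℚ))) ⟩
    fromℕ (twiceEdges G) + 2ℚ ∎
    where open ≡-Reasoning

-- The update of the resistances is the Sherman–Morrison formula for the rank-one change of the Laplacian.
module ResistanceUpdate {n} {G : Graph n} (G-sym : Symmetric G) {R : Fin n → Fin n → ℚ} (isR : IsResistance G R)
                        {u w : Fin n} (u≢w : u ≢ w) (Guw : G u w ≡ false)
                        {ρ⁻¹ : ℚ} (ρ-inverse : (1ℚ + R u w) * ρ⁻¹ ≡ 1ℚ) where

  open IsResistance isR
  open AddEdge G-sym u≢w Guw public
  open ≡-Reasoning

  α : Fin n → ℚ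
  α a = ½ * (R a w - R a u)

  R′ : Fin n → Fin n → ℚ
  R′ a b = R a b - ρ⁻¹ * ((α a - α b) * (α a - α b))

  private
    A : Fin n → Fin n → ℚ
    A a b = b2q (G a b)

  Σ-A-α : ∀ l → Σ (λ a → A l a * (α l - α a)) ≡ δ l u - δ l w
  Σ-A-α l = begin
    Σ (λ a → A l a * (α l - α a))
      ≡⟨ Σ-cong (λ a → split (A l a) (R l w) (R l u) (R a w) (R a u)) ⟩
    Σ (λ a → ½ * (A l a * (R l w - R a w) - A l a * (R l u - R a u)))
      ≡⟨ Σ-*ˡ {n} ½ _ ⟩
    ½ * Σ (λ a → A l a * (R l w - R a w) - A l a * (R l u - R a u))
      ≡⟨ cong (½ *_) (Σ-distrib-sub {n} _ _) ⟩
    ½ * (Σ (λ a → A l a * (R l w - R a w)) - Σ (λ a → A l a * (R l u - R a u)))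
      ≡⟨ cong₂ (λ x y → ½ * (x - y)) (laplacian l w) (laplacian l u) ⟩
    ½ * ((potential l - 2ℚ * δ l w) - (potential l - 2ℚ * δ l u))
      ≡⟨ simplify (potential l) (δ l w) (δ l u) ⟩
    δ l u - δ l w ∎
    where
    split : ∀ g rlw rlu raw rau → g * (½ * (rlw - rlu) - ½ * (raw - rau)) ≡ ½ * (g * (rlw - raw) - g * (rlu - rau))
    split = solve-∀ ringℚ
    simplify : ∀ v x y → ½ * ((v - 2ℚ * x) - (v - 2ℚ * y)) ≡ y - x
    simplify = solve-∀ ringℚ

  R′-w-u : ∀ x → R′ w x - R′ u x ≡ 2ℚ * ρ⁻¹ * α x
  R′-w-u x = begin
    R′ w x - R′ u x
      ≡⟨ cong₂ (λ s t → s - ρ⁻¹ * ((α w - α x) * (α w - α x)) - (t - ρ⁻¹ * ((α u - α x) * (α u - α x))))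
               (symmetric w x) (symmetric u x) ⟩
    R x w - ρ⁻¹ * ((α w - α x) * (α w - α x)) - (R x u - ρ⁻¹ * ((α u - α x) * (α u - α x)))
      ≡⟨ cong₂ (λ s t → R x w - ρ⁻¹ * ((t - α x) * (t - α x)) - (R x u - ρ⁻¹ * ((s - α x) * (s - α x)))) αu αw ⟩
    R x w - ρ⁻¹ * ((- (½ * r) - α x) * (- (½ * r) - α x)) - (R x u - ρ⁻¹ * ((½ * r - α x) * (½ * r - α x)))
      ≡⟨ expand (R x u) (R x w) r ρ⁻¹ ⟩
    2ℚ * ρ⁻¹ * α x + (R x w - R x u) * (1ℚ - (1ℚ + r) * ρ⁻¹)
      ≡⟨ cong (λ z → 2ℚ * ρ⁻¹ * α x + (R x w - R x u) * (1ℚ - z)) ρ-inverse ⟩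
    2ℚ * ρ⁻¹ * α x + (R x w - R x u) * (1ℚ - 1ℚ)
      ≡⟨ vanish (2ℚ * ρ⁻¹ * α x) (R x w - R x u) ⟩
    2ℚ * ρ⁻¹ * α x
      ∎
    where
    r : ℚ
    r = R u w
    αu : α u ≡ ½ * r
    αu = trans (cong (λ z → ½ * (r - z)) (zero-diagonal u)) (cong (½ *_) (ℚₚ.+-identityʳ r))
    αw : α w ≡ - (½ * r)
    αw = trans (cong₂ (λ y z → ½ * (y - z)) (zero-diagonal w) (symmetric w u)) (neg r)
      where
      neg : ∀ r → ½ * (0ℚ - r) ≡ - (½ * r)
      neg = solve-∀ ringℚ
    expand : ∀ xu xw r ρ⁻¹ →
      xw - ρ⁻¹ * ((- (½ * r) - ½ * (xw - xu)) * (- (½ * r) - ½ * (xw - xu)))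
        - (xu - ρ⁻¹ * ((½ * r - ½ * (xw - xu)) * (½ * r - ½ * (xw - xu))))
        ≡ 2ℚ * ρ⁻¹ * (½ * (xw - xu)) + (xw - xu) * (1ℚ - (1ℚ + r) * ρ⁻¹)
    expand = solve-∀ ringℚ
    vanish : ∀ y z → y + z * (1ℚ - 1ℚ) ≡ y
    vanish = solve-∀ ringℚ

  potential′ : Fin n → ℚ
  potential′ l = potential l - ρ⁻¹ * Σ (λ a → A l a * (α l * α l - α a * α a))

  -- The two terms of the new edge cancel the c (δ l u - δ l w) left over by the old edges.
  laplacian′ : ∀ l x → Σ (λ a → b2q (G′ l a) * (R′ l x - R′ a x)) ≡ potential′ l - 2ℚ * δ l x
  laplacian′ l x = begin
    Σ (λ a → b2q (G′ l a) * (R′ l x - R′ a x))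
      ≡⟨ Σ-addEdge l (λ a → R′ l x - R′ a x) ⟩
    Σ (λ a → A l a * (R′ l x - R′ a x)) + δ l u * (R′ l x - R′ w x) + δ l w * (R′ l x - R′ u x)
      ≡⟨ cong₂ (λ s t → s + t + δ l w * (R′ l x - R′ u x)) old-edges new-edge-u ⟩
    (1ℚ * (potential l - 2ℚ * δ l x) - ρ⁻¹ * B + c * (δ l u - δ l w)) + δ l u * (- c) + δ l w * (R′ l x - R′ u x)
      ≡⟨ cong ((1ℚ * (potential l - 2ℚ * δ l x) - ρ⁻¹ * B + c * (δ l u - δ l w)) + δ l u * (- c) +_) new-edge-w ⟩
    (1ℚ * (potential l - 2ℚ * δ l x) - ρ⁻¹ * B + c * (δ l u - δ l w)) + δ l u * (- c) + δ l w * c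
      ≡⟨ collect (potential l) (δ l x) ρ⁻¹ B c (δ l u) (δ l w) ⟩
    potential′ l - 2ℚ * δ l x
      ∎
    where
    c B : ℚ
    c = 2ℚ * ρ⁻¹ * α x
    B = Σ (λ a → A l a * (α l * α l - α a * α a))
    collect : ∀ v dx r B c du dw → (1ℚ * (v - 2ℚ * dx) - r * B + c * (du - dw)) + du * (- c) + dw * c ≡ (v - r * B) - 2ℚ * dx
    collect = solve-∀ ringℚ
    expand : ∀ g rlx rax al aa ax r → g * ((rlx - r * ((al - ax) * (al - ax))) - (rax - r * ((aa - ax) * (aa - ax))))
             ≡ 1ℚ * (g * (rlx - rax)) - r * (g * (al * al - aa * aa)) + (2ℚ * r * ax) * (g * (al - aa))
    expand = solve-∀ ringℚ
    old-edges : Σ (λ a → A l a * (R′ l x - R′ a x)) ≡ 1ℚ * (potential l - 2ℚ * δ l x) - ρ⁻¹ * B + c * (δ l u - δ l w)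
    old-edges = begin
      Σ (λ a → A l a * (R′ l x - R′ a x))
        ≡⟨ Σ-cong (λ a → expand (A l a) (R l x) (R a x) (α l) (α a) (α x) ρ⁻¹) ⟩
      Σ (λ a → 1ℚ * (A l a * (R l x - R a x)) - ρ⁻¹ * (A l a * (α l * α l - α a * α a)) + c * (A l a * (α l - α a)))
        ≡⟨ Σ-lincomb (λ a → A l a * (R l x - R a x)) (λ a → A l a * (α l * α l - α a * α a))
                     (λ a → A l a * (α l - α a)) 1ℚ ρ⁻¹ c ⟩
      1ℚ * Σ (λ a → A l a * (R l x - R a x)) - ρ⁻¹ * B + c * Σ (λ a → A l a * (α l - α a))
        ≡⟨ cong₂ (λ s t → 1ℚ * s - ρ⁻¹ * B + c * t) (laplacian l x) (Σ-A-α l) ⟩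
      1ℚ * (potential l - 2ℚ * δ l x) - ρ⁻¹ * B + c * (δ l u - δ l w)
        ∎
    new-edge-u : δ l u * (R′ l x - R′ w x) ≡ δ l u * (- c)
    new-edge-u = trans (δ-subst l u (λ t → R′ t x - R′ w x))
                       (cong (δ l u *_) (trans (flip (R′ u x) (R′ w x)) (cong -_ (R′-w-u x))))
      where
      flip : ∀ a b → a - b ≡ - (b - a)
      flip = solve-∀ ringℚ
    new-edge-w : δ l w * (R′ l x - R′ u x) ≡ δ l w * c
    new-edge-w = trans (δ-subst l w (λ t → R′ t x - R′ u x)) (cong (δ l w *_) (R′-w-u x))

  isResistance′ : IsResistance G′ R′
  isResistance′ = record
    { symmetric     = λ a b → cong₂ (λ s t → s - ρ⁻¹ * t) (symmetric a b) (sq-diff-sym (α a) (α b))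
    ; zero-diagonal = λ a → trans (cong (λ s → s - ρ⁻¹ * ((α a - α a) * (α a - α a))) (zero-diagonal a)) (vanish ρ⁻¹ (α a))
    ; potential     = potential′
    ; laplacian     = laplacian′
    }
    where
    sq-diff-sym : ∀ x y → (x - y) * (x - y) ≡ (y - x) * (y - x)
    sq-diff-sym = solve-∀ ringℚ
    vanish : ∀ r x → 0ℚ - r * ((x - x) * (x - x)) ≡ 0ℚ
    vanish = solve-∀ ringℚ

  d : Fin n → ℚ
  d = degℚ G

  private
    d′ : Fin n → ℚ
    d′ a = d a + (δ a u + δ a w)

  r : Fin n → ℚ
  r x = Σ (λ a → d a * R a x)

  S₁ S₂ : ℚ
  S₁ = Σ (λ a → d a * α a) + (α u + α w)
  S₂ = Σ (λ a → d a * (α a * α a)) + (α u * α u + α w * α w)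

  private
    W : (Fin n → ℚ) → (Fin n → Fin n → ℚ) → ℚ
    W x M = Σ (λ b → Σ (λ a → x a * x b * M a b))

    W-bump : W d′ R ≡ weightedResistance G R + 2ℚ * (r u + r w) + 2ℚ * R u w
    W-bump = begin
      W d′ R
        ≡⟨ Σ-cong (λ b → trans (Σ-cong (λ a → swap (d′ a) (d′ b) (R a b))) (Σ-*ˡ {n} (d′ b) _)) ⟩
      Σ (λ b → d′ b * Σ (λ a → d′ a * R a b))
        ≡⟨ Σ-cong (λ b → cong (d′ b *_) (Σ-bump u w d (λ a → R a b))) ⟩
      Σ (λ b → d′ b * g b)
        ≡⟨ Σ-bump u w d g ⟩
      Σ (λ b → d b * g b) + (g u + g w)
        ≡⟨ cong₂ _+_ Σdg (cong₂ (λ s t → g u + (r w + (t + s))) (zero-diagonal w) (symmetric u w)) ⟩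
      (weightedResistance G R + (r u + r w)) + (g u + (r w + (R w u + 0ℚ)))
        ≡⟨ cong (λ s → (weightedResistance G R + (r u + r w)) + (r u + (s + R w u) + (r w + (R w u + 0ℚ)))) (zero-diagonal u) ⟩
      (weightedResistance G R + (r u + r w)) + (r u + (0ℚ + R w u) + (r w + (R w u + 0ℚ)))
        ≡⟨ collect (weightedResistance G R) (r u) (r w) (R w u) ⟩
      weightedResistance G R + 2ℚ * (r u + r w) + 2ℚ * R w u
        ≡⟨ cong (λ s → weightedResistance G R + 2ℚ * (r u + r w) + 2ℚ * s) (symmetric w u) ⟩
      weightedResistance G R + 2ℚ * (r u + r w) + 2ℚ * R u w ∎
      where
      g : Fin n → ℚ
      g b = r b + (R u b + R w b)
      swap : ∀ x y z → x * y * z ≡ y * (x * z)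
      swap = solve-∀ ringℚ
      collect : ∀ W a b c → (W + (a + b)) + (a + (0ℚ + c) + (b + (c + 0ℚ))) ≡ W + 2ℚ * (a + b) + 2ℚ * c
      collect = solve-∀ ringℚ
      Σd-R : ∀ x → Σ (λ b → d b * R x b) ≡ r x
      Σd-R x = Σ-cong (λ b → cong (d b *_) (symmetric x b))
      Σdr : Σ (λ b → d b * r b) ≡ weightedResistance G R
      Σdr = Σ-cong (λ b → trans (sym (Σ-*ˡ {n} (d b) _)) (Σ-cong (λ a → swap′ (d b) (d a) (R a b))))
        where
        swap′ : ∀ x y z → x * (y * z) ≡ y * x * z
        swap′ = solve-∀ ringℚ
      Σdg : Σ (λ b → d b * g b) ≡ weightedResistance G R + (r u + r w)
      Σdg = begin
        Σ (λ b → d b * g b)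
          ≡⟨ Σ-cong (λ b → split (d b) (r b) (R u b) (R w b)) ⟩
        Σ (λ b → d b * r b + (d b * R u b + d b * R w b))
          ≡⟨ Σ-distrib-+ {n} _ _ ⟩
        Σ (λ b → d b * r b) + Σ (λ b → d b * R u b + d b * R w b)
          ≡⟨ cong₂ _+_ Σdr (trans (Σ-distrib-+ {n} _ _) (cong₂ _+_ (Σd-R u) (Σd-R w))) ⟩
        weightedResistance G R + (r u + r w) ∎
        where
        split : ∀ x a b c → x * (a + (b + c)) ≡ x * a + (x * b + x * c)
        split = solve-∀ ringℚ

  weightedResistance-addEdge :
    weightedResistance G′ R′
      ≡ (weightedResistance G R + 2ℚ * (r u + r w) + 2ℚ * R u w) - ρ⁻¹ * (2ℚ * (Σ d + 2ℚ) * S₂ - 2ℚ * (S₁ * S₁))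
  weightedResistance-addEdge = begin
    weightedResistance G′ R′
      ≡⟨ Σ-cong (λ b → Σ-cong (λ a → cong₂ (λ x y → x * y * R′ a b) (degℚ-addEdge a) (degℚ-addEdge b))) ⟩
    W d′ R′
      ≡⟨ Σ-cong inner ⟩
    Σ (λ b → Σ (λ a → d′ a * d′ b * R a b) - ρ⁻¹ * Σ (λ a → d′ a * d′ b * D a b))
      ≡⟨ trans (Σ-distrib-sub (λ b → Σ (λ a → d′ a * d′ b * R a b)) (λ b → ρ⁻¹ * Σ (λ a → d′ a * d′ b * D a b)))
          (cong (λ t → W d′ R - t) (Σ-*ˡ ρ⁻¹ (λ b → Σ (λ a → d′ a * d′ b * D a b)))) ⟩
    W d′ R - ρ⁻¹ * W d′ D
      ≡⟨ cong₂ (λ s t → s - ρ⁻¹ * t) W-bump (Σ²-sq-diff d′ α) ⟩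
    T₁ - ρ⁻¹ * (2ℚ * Σ d′ * Σ (λ a → d′ a * (α a * α a)) - 2ℚ * (Σ (λ a → d′ a * α a) * Σ (λ a → d′ a * α a)))
      ≡⟨ cong (λ s → T₁ - ρ⁻¹ * (2ℚ * Σ d′ * s - 2ℚ * (Σ (λ a → d′ a * α a) * Σ (λ a → d′ a * α a))))
              (Σ-bump u w d (λ a → α a * α a)) ⟩
    T₁ - ρ⁻¹ * (2ℚ * Σ d′ * S₂ - 2ℚ * (Σ (λ a → d′ a * α a) * Σ (λ a → d′ a * α a)))
      ≡⟨ cong₂ (λ s t → T₁ - ρ⁻¹ * (2ℚ * s * S₂ - 2ℚ * (t * t))) Σd′ (Σ-bump u w d α) ⟩
    T₁ - ρ⁻¹ * (2ℚ * (Σ d + 2ℚ) * S₂ - 2ℚ * (S₁ * S₁))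
      ∎
    where
    T₁ : ℚ
    T₁ = weightedResistance G R + 2ℚ * (r u + r w) + 2ℚ * R u w
    D : Fin n → Fin n → ℚ
    D a b = (α a - α b) * (α a - α b)
    distrib : ∀ x s t ρ → x * (s - ρ * t) ≡ x * s - ρ * (x * t)
    distrib = solve-∀ ringℚ
    inner : ∀ b → Σ (λ a → d′ a * d′ b * R′ a b)
                  ≡ Σ (λ a → d′ a * d′ b * R a b) - ρ⁻¹ * Σ (λ a → d′ a * d′ b * D a b)
    inner b = trans (Σ-cong (λ a → distrib (d′ a * d′ b) (R a b) (D a b) ρ⁻¹))
      (trans (Σ-distrib-sub (λ a → d′ a * d′ b * R a b) (λ a → ρ⁻¹ * (d′ a * d′ b * D a b)))
             (cong (λ t → Σ (λ a → d′ a * d′ b * R a b) - t) (Σ-*ˡ ρ⁻¹ (λ a → d′ a * d′ b * D a b))))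
    Σd′ : Σ d′ ≡ Σ d + 2ℚ
    Σd′ = trans (Σ-distrib-+ d (λ a → δ a u + δ a w))
                (cong (Σ d +_) (trans (Σ-cong (λ a → sym (ℚₚ.*-identityʳ (δ a u + δ a w)))) (Σ-pair u w (λ _ → 1ℚ))))

-- The broom

≡true : ∀ {b} → T b → b ≡ true
≡true {true} _ = refl

≡false : ∀ {b} → ¬ T b → b ≡ false
≡false {false} _   = refl
≡false {true}  ¬tt = ⊥-elim (¬tt _)

<ᵇ-true : ∀ {m n} → m < n → (m <ᵇ n) ≡ true
<ᵇ-true m<n = ≡true (ℕₚ.<⇒<ᵇ m<n)

<ᵇ-false : ∀ {m n} → n ℕ.≤ m → (m <ᵇ n) ≡ false
<ᵇ-false {m} {n} n≤m = ≡false (λ m<ᵇn → ℕₚ.<⇒≱ (ℕₚ.<ᵇ⇒< m n m<ᵇn) n≤m)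

≤ᵇ-true : ∀ {m n} → m ℕ.≤ n → (m ≤ᵇ n) ≡ true
≤ᵇ-true m≤n = ≡true (ℕₚ.≤⇒≤ᵇ m≤n)

≤ᵇ-false : ∀ {m n} → n < m → (m ≤ᵇ n) ≡ false
≤ᵇ-false {m} {n} n<m = ≡false (λ m≤ᵇn → ℕₚ.<⇒≱ n<m (ℕₚ.≤ᵇ⇒≤ m n m≤ᵇn))

≡ᵇ-false : ∀ {m n} → m ≢ n → (m ≡ᵇ n) ≡ false
≡ᵇ-false {m} {n} m≢n = ≡false (λ m≡ᵇn → m≢n (ℕₚ.≡ᵇ⇒≡ m n m≡ᵇn))

≡ᵇ-refl : ∀ n → (n ≡ᵇ n) ≡ true
≡ᵇ-refl n = ≡true (ℕₚ.≡⇒≡ᵇ n n refl)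

δ-toℕ : ∀ {n} (a b : Fin n) → δ a b ≡ b2q (toℕ a ≡ᵇ toℕ b)
δ-toℕ a b with a Finₚ.≟ b
... | yes refl = cong b2q (sym (≡ᵇ-refl (toℕ a)))
... | no a≢b   = cong b2q (sym (≡ᵇ-false (a≢b ∘ Finₚ.toℕ-injective)))

fromℕ-∣-∣ : ∀ {m n} → n ℕ.≤ m → fromℕ ∣ m - n ∣ ≡ fromℕ m - fromℕ n
fromℕ-∣-∣ {m} {n} n≤m = trans (cong fromℕ (ℕₚ.m≤n⇒∣n-m∣≡n∸m n≤m)) (fromℕ-∸ m n n≤m)

fromℕ-∣-∣′ : ∀ {m n} → m ℕ.≤ n → fromℕ ∣ m - n ∣ ≡ fromℕ n - fromℕ m
fromℕ-∣-∣′ {m} {n} m≤n = trans (cong fromℕ (ℕₚ.m≤n⇒∣m-n∣≡n∸m m≤n)) (fromℕ-∸ n m m≤n)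

-- The Laplacian of the path 0, 1, 2, … applied to y ↦ ∣ y - c ∣, at the end 0 and at an inner vertex.
∣-∣-first-difference : ∀ c → fromℕ ∣ 0 - c ∣ - fromℕ ∣ 1 - c ∣ ≡ (2ℚ - 1ℚ) - 2ℚ * b2q (0 ≡ᵇ c)
∣-∣-first-difference zero    = cong₂ _-_ fromℕ-0 fromℕ-1
∣-∣-first-difference (suc c) = trans (cong (_- fromℕ c) (fromℕ-suc c)) (step (fromℕ c))
  where
  step : ∀ x → 1ℚ + x - x ≡ (2ℚ - 1ℚ) - 2ℚ * 0ℚ
  step = solve-∀ ringℚ

∣-∣-second-difference : ∀ x c →
  (fromℕ ∣ suc x - c ∣ - fromℕ ∣ suc (suc x) - c ∣) + (fromℕ ∣ suc x - c ∣ - fromℕ ∣ x - c ∣)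
    ≡ (2ℚ - 2ℚ) - 2ℚ * b2q (suc x ≡ᵇ c)
∣-∣-second-difference x zero = begin
  (fromℕ (suc x) - fromℕ (suc (suc x))) + (fromℕ (suc x) - fromℕ ∣ x - 0 ∣)
    ≡⟨ cong (λ z → (fromℕ (suc x) - fromℕ (suc (suc x))) + (fromℕ (suc x) - fromℕ z)) (ℕₚ.∣-∣-identityʳ x) ⟩
  (fromℕ (suc x) - fromℕ (suc (suc x))) + (fromℕ (suc x) - fromℕ x)
    ≡⟨ cong₂ (λ a b → (a - b) + (a - fromℕ x)) (fromℕ-suc x) (trans (fromℕ-suc (suc x)) (cong (1ℚ +_) (fromℕ-suc x))) ⟩
  (1ℚ + fromℕ x - (1ℚ + (1ℚ + fromℕ x))) + (1ℚ + fromℕ x - fromℕ x)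
    ≡⟨ step (fromℕ x) ⟩
  (2ℚ - 2ℚ) - 2ℚ * 0ℚ
    ∎
  where
  open ≡-Reasoning
  step : ∀ y → (1ℚ + y - (1ℚ + (1ℚ + y))) + (1ℚ + y - y) ≡ (2ℚ - 2ℚ) - 2ℚ * 0ℚ
  step = solve-∀ ringℚ
∣-∣-second-difference zero    (suc zero) = cong₂ (λ a b → (a - b) + (a - b)) fromℕ-0 fromℕ-1
∣-∣-second-difference zero    (suc (suc c)) = begin
  (fromℕ (suc c) - fromℕ c) + (fromℕ (suc c) - fromℕ (suc (suc c)))
    ≡⟨ cong₂ (λ a b → (a - fromℕ c) + (a - b)) (fromℕ-suc c) (trans (fromℕ-suc (suc c)) (cong (1ℚ +_) (fromℕ-suc c))) ⟩
  (1ℚ + fromℕ c - fromℕ c) + (1ℚ + fromℕ c - (1ℚ + (1ℚ + fromℕ c)))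
    ≡⟨ step (fromℕ c) ⟩
  (2ℚ - 2ℚ) - 2ℚ * 0ℚ
    ∎
  where
  open ≡-Reasoning
  step : ∀ y → (1ℚ + y - y) + (1ℚ + y - (1ℚ + (1ℚ + y))) ≡ (2ℚ - 2ℚ) - 2ℚ * 0ℚ
  step = solve-∀ ringℚ
∣-∣-second-difference (suc x) (suc c) = ∣-∣-second-difference x c

-- The leaves sit at depth k, one step beyond the centre k - 1; two distinct leaves are at distance 2.
broomDist : ℕ → ℕ → ℕ → ℕ
broomDist k x y = if (k ≤ᵇ x) ∧ (k ≤ᵇ y) ∧ not (x ≡ᵇ y) then 2 else ∣ x ⊓ k - y ⊓ k ∣

broomDist-sym : ∀ k x y → broomDist k x y ≡ broomDist k y x
broomDist-sym k x y = cong₂ (λ b d → if b then 2 else d) leaves (ℕₚ.∣-∣-comm (x ⊓ k) (y ⊓ k))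
  where
  leaves : ((k ≤ᵇ x) ∧ (k ≤ᵇ y) ∧ not (x ≡ᵇ y)) ≡ ((k ≤ᵇ y) ∧ (k ≤ᵇ x) ∧ not (y ≡ᵇ x))
  leaves = trans (sym (Boolₚ.∧-assoc (k ≤ᵇ x) (k ≤ᵇ y) _))
    (trans (cong₂ _∧_ (Boolₚ.∧-comm (k ≤ᵇ x) (k ≤ᵇ y)) (cong not (≡ᵇ-sym x y))) (Boolₚ.∧-assoc (k ≤ᵇ y) (k ≤ᵇ x) _))

broomDist-diag : ∀ k x → broomDist k x x ≡ 0
broomDist-diag k x = begin
  (if (k ≤ᵇ x) ∧ (k ≤ᵇ x) ∧ not (x ≡ᵇ x) then 2 else ∣ x ⊓ k - x ⊓ k ∣)
    ≡⟨ cong (λ b → if (k ≤ᵇ x) ∧ (k ≤ᵇ x) ∧ not b then 2 else ∣ x ⊓ k - x ⊓ k ∣) (≡ᵇ-refl x) ⟩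
  (if (k ≤ᵇ x) ∧ (k ≤ᵇ x) ∧ false then 2 else ∣ x ⊓ k - x ⊓ k ∣)
    ≡⟨ cong (λ b → if b then 2 else ∣ x ⊓ k - x ⊓ k ∣)
            (trans (cong ((k ≤ᵇ x) ∧_) (Boolₚ.∧-zeroʳ (k ≤ᵇ x))) (Boolₚ.∧-zeroʳ (k ≤ᵇ x))) ⟩
  ∣ x ⊓ k - x ⊓ k ∣
    ≡⟨ ℕₚ.∣n-n∣≡0 (x ⊓ k) ⟩
  0 ∎
  where open ≡-Reasoning

broomDist-from-path : ∀ {k x y} → x < k → broomDist k x y ≡ ∣ x - y ⊓ k ∣
broomDist-from-path {k} {x} {y} x<k = cong₂ (λ b z → if b ∧ (k ≤ᵇ y) ∧ not (x ≡ᵇ y) then 2 else ∣ z - y ⊓ k ∣)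
                                       (≤ᵇ-false x<k) (ℕₚ.m≤n⇒m⊓n≡m (ℕₚ.<⇒≤ x<k))

broomDist-path-path : ∀ {k x y} → x < k → y < k → broomDist k x y ≡ ∣ x - y ∣
broomDist-path-path {k} {x} {y} x<k y<k =
  trans (broomDist-from-path x<k) (cong (λ z → ∣ x - z ∣) (ℕₚ.m≤n⇒m⊓n≡m (ℕₚ.<⇒≤ y<k)))

broomDist-path-leaf : ∀ {k x y} → x < k → k ℕ.≤ y → broomDist k x y ≡ ∣ x - k ∣
broomDist-path-leaf {k} {x} {y} x<k k≤y =
  trans (broomDist-from-path x<k) (cong (λ z → ∣ x - z ∣) (ℕₚ.m≥n⇒m⊓n≡n k≤y))

broomDist-leaf-leaf : ∀ {k x y} → k ℕ.≤ x → k ℕ.≤ y → broomDist k x y ≡ (if x ≡ᵇ y then 0 else 2)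
broomDist-leaf-leaf {k} {x} {y} k≤x k≤y with x ≡ᵇ y
... | true  = trans (cong₂ (λ a b → if a ∧ b ∧ false then 2 else ∣ x ⊓ k - y ⊓ k ∣) (≤ᵇ-true k≤x) (≤ᵇ-true k≤y))
              (trans (cong₂ (λ a b → ∣ a - b ∣) (ℕₚ.m≥n⇒m⊓n≡n k≤x) (ℕₚ.m≥n⇒m⊓n≡n k≤y)) (ℕₚ.∣n-n∣≡0 k))
... | false = cong₂ (λ a b → if a ∧ b ∧ true then 2 else ∣ x ⊓ k - y ⊓ k ∣) (≤ᵇ-true k≤x) (≤ᵇ-true k≤y)

broomAdj-sym : ∀ k x y → broomAdj k x y ≡ broomAdj k y x
broomAdj-sym k x y = cong₂ _∨_ path (Boolₚ.∨-comm ((suc x ≡ᵇ k) ∧ (k ≤ᵇ y)) ((suc y ≡ᵇ k) ∧ (k ≤ᵇ x)))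
  where
  path : ((x <ᵇ k) ∧ (y <ᵇ k) ∧ ((suc x ≡ᵇ y) ∨ (suc y ≡ᵇ x)))
       ≡ ((y <ᵇ k) ∧ (x <ᵇ k) ∧ ((suc y ≡ᵇ x) ∨ (suc x ≡ᵇ y)))
  path = trans (sym (Boolₚ.∧-assoc (x <ᵇ k) (y <ᵇ k) _))
    (trans (cong₂ _∧_ (Boolₚ.∧-comm (x <ᵇ k) (y <ᵇ k)) (Boolₚ.∨-comm (suc x ≡ᵇ y) (suc y ≡ᵇ x)))
           (Boolₚ.∧-assoc (y <ᵇ k) (x <ᵇ k) _))

broomAdj-path-path : ∀ {k x y} → x < k → y < k → broomAdj k x y ≡ ((suc x ≡ᵇ y) ∨ (suc y ≡ᵇ x))
broomAdj-path-path {k} {x} {y} x<k y<k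
  rewrite <ᵇ-true x<k | <ᵇ-true y<k | ≤ᵇ-false x<k | ≤ᵇ-false y<k
        | Boolₚ.∧-zeroʳ (suc x ≡ᵇ k) | Boolₚ.∧-zeroʳ (suc y ≡ᵇ k) = Boolₚ.∨-identityʳ _

broomAdj-path-leaf : ∀ {k x y} → x < k → k ℕ.≤ y → broomAdj k x y ≡ (suc x ≡ᵇ k)
broomAdj-path-leaf {k} {x} {y} x<k k≤y
  rewrite <ᵇ-true x<k | <ᵇ-false k≤y | ≤ᵇ-true k≤y | ≤ᵇ-false x<k
        | Boolₚ.∧-identityʳ (suc x ≡ᵇ k) | Boolₚ.∧-zeroʳ (suc y ≡ᵇ k) = Boolₚ.∨-identityʳ _

broomAdj-leaf-path : ∀ {k x y} → k ℕ.≤ x → y < k → broomAdj k x y ≡ (suc y ≡ᵇ k)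
broomAdj-leaf-path {k} {x} {y} k≤x y<k
  rewrite <ᵇ-false k≤x | ≡ᵇ-false {suc x} {k} (ℕₚ.<⇒≢ (s≤s k≤x) ∘ sym) | ≤ᵇ-true k≤x
        | Boolₚ.∧-identityʳ (suc y ≡ᵇ k) = refl

broomAdj-leaf-leaf : ∀ {k x y} → k ℕ.≤ x → k ℕ.≤ y → broomAdj k x y ≡ false
broomAdj-leaf-leaf {k} {x} {y} k≤x k≤y
  rewrite <ᵇ-false k≤x | ≡ᵇ-false {suc x} {k} (ℕₚ.<⇒≢ (s≤s k≤x) ∘ sym)
        | ≡ᵇ-false {suc y} {k} (ℕₚ.<⇒≢ (s≤s k≤y) ∘ sym) = refl

successor-disjoint : ∀ x y → ((suc x ≡ᵇ y) ∧ (suc y ≡ᵇ x)) ≡ false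
successor-disjoint zero    zero    = refl
successor-disjoint zero    (suc y) = Boolₚ.∧-zeroʳ (zero ≡ᵇ y)
successor-disjoint (suc x) zero    = refl
successor-disjoint (suc x) (suc y) = successor-disjoint x y

-- k = t + 2: the path is 0, …, t + 1 with centre t + 1, and the leaves are k, …, k + p - 1.
module Broom (t p : ℕ) where

  open ≡-Reasoning

  k n : ℕ
  k = suc (suc t)
  n = k ℕ.+ p

  private
    t<k : t < k
    t<k = ℕₚ.m<n+m t (s≤s z≤n)

    centre<k : suc t < k
    centre<k = ℕₚ.n<1+n (suc t)

    leaf : ∀ j → k ℕ.≤ k ℕ.+ j
    leaf = ℕₚ.m≤m+n k

  nbrSum : ℕ → (ℕ → ℚ) → ℚ
  nbrSum x f = Σ< n (λ y → b2q (broomAdj k x y) * f y)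

  nbrSum-path : ∀ {x} (f : ℕ → ℚ) → x < k →
    nbrSum x f ≡ (Σ< k (λ y → b2q (suc x ≡ᵇ y) * f y) + Σ< k (λ y → b2q (suc y ≡ᵇ x) * f y))
                 + b2q (suc x ≡ᵇ k) * Σ< p (λ j → f (k ℕ.+ j))
  nbrSum-path {x} f x<k = trans (Σ<-split k p (λ y → b2q (broomAdj k x y) * f y)) (cong₂ _+_
    (trans (Σ<-cong k path)
           (Σ-distrib-+ {k} (λ a → b2q (suc x ≡ᵇ toℕ a) * f (toℕ a)) (λ a → b2q (suc (toℕ a) ≡ᵇ x) * f (toℕ a))))
    (trans (Σ<-cong p leaves) (Σ-*ˡ {p} (b2q (suc x ≡ᵇ k)) (λ a → f (k ℕ.+ toℕ a)))))
    where
    path : ∀ y → y < k → b2q (broomAdj k x y) * f y ≡ b2q (suc x ≡ᵇ y) * f y + b2q (suc y ≡ᵇ x) * f y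
    path y y<k = begin
      b2q (broomAdj k x y) * f y
        ≡⟨ cong (λ b → b2q b * f y) (broomAdj-path-path x<k y<k) ⟩
      b2q ((suc x ≡ᵇ y) ∨ (suc y ≡ᵇ x)) * f y
        ≡⟨ cong (_* f y) (b2q-∨ (suc x ≡ᵇ y) (suc y ≡ᵇ x) (successor-disjoint x y)) ⟩
      (b2q (suc x ≡ᵇ y) + b2q (suc y ≡ᵇ x)) * f y
        ≡⟨ ℚₚ.*-distribʳ-+ (f y) (b2q (suc x ≡ᵇ y)) (b2q (suc y ≡ᵇ x)) ⟩
      b2q (suc x ≡ᵇ y) * f y + b2q (suc y ≡ᵇ x) * f y
        ∎
    leaves : ∀ j → j < p → b2q (broomAdj k x (k ℕ.+ j)) * f (k ℕ.+ j) ≡ b2q (suc x ≡ᵇ k) * f (k ℕ.+ j)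
    leaves j _ = cong (λ b → b2q b * f (k ℕ.+ j)) (broomAdj-path-leaf x<k (leaf j))

  nbrSum-0 : ∀ f → nbrSum 0 f ≡ f 1
  nbrSum-0 f = begin
    nbrSum 0 f
      ≡⟨ nbrSum-path f (s≤s z≤n) ⟩
    (Σ< k (λ y → b2q (1 ≡ᵇ y) * f y) + Σ< k (λ y → 0ℚ * f y)) + 0ℚ * leaves
      ≡⟨ cong₂ (λ a b → (a + b) + 0ℚ * leaves) (Σ<-indicator k 1 f (s≤s (s≤s z≤n))) none ⟩
    (f 1 + 0ℚ) + 0ℚ * leaves
      ≡⟨ vanish (f 1) leaves ⟩
    f 1 ∎
    where
    leaves : ℚ
    leaves = Σ< p (λ j → f (k ℕ.+ j))
    none : Σ< k (λ y → 0ℚ * f y) ≡ 0ℚ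
    none = trans (Σ<-cong k (λ y _ → ℚₚ.*-zeroˡ (f y))) (Σ-zero k)
    vanish : ∀ x y → (x + 0ℚ) + 0ℚ * y ≡ x
    vanish = solve-∀ ringℚ

  nbrSum-inner : ∀ {x} f → x < t → nbrSum (suc x) f ≡ f (suc (suc x)) + f x
  nbrSum-inner {x} f x<t = begin
    nbrSum (suc x) f
      ≡⟨ nbrSum-path f (s≤s (s≤s (ℕₚ.<⇒≤ x<t))) ⟩
    (Σ< k (λ y → b2q (suc (suc x) ≡ᵇ y) * f y) + Σ< k (λ y → b2q (y ≡ᵇ x) * f y)) + b2q (x ≡ᵇ t) * leaves
      ≡⟨ cong₂ (λ a b → a + b2q b * leaves)
               (cong₂ _+_ (Σ<-indicator k _ f (s≤s (s≤s x<t))) (Σ<-indicator′ k x f x<k)) (≡ᵇ-false (ℕₚ.<⇒≢ x<t)) ⟩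
    (f (suc (suc x)) + f x) + 0ℚ * leaves
      ≡⟨ vanish (f (suc (suc x)) + f x) leaves ⟩
    f (suc (suc x)) + f x
      ∎
    where
    leaves : ℚ
    leaves = Σ< p (λ j → f (k ℕ.+ j))
    x<k : x < k
    x<k = ℕₚ.<-trans x<t t<k
    vanish : ∀ x y → x + 0ℚ * y ≡ x
    vanish = solve-∀ ringℚ

  nbrSum-centre : ∀ f → nbrSum (suc t) f ≡ f t + Σ< p (λ j → f (k ℕ.+ j))
  nbrSum-centre f = begin
    nbrSum (suc t) f
      ≡⟨ nbrSum-path f centre<k ⟩
    (Σ< k (λ y → b2q (k ≡ᵇ y) * f y) + Σ< k (λ y → b2q (y ≡ᵇ t) * f y)) + b2q (t ≡ᵇ t) * leaves
      ≡⟨ cong₂ (λ a b → a + b2q b * leaves)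
               (cong₂ _+_ (Σ<-indicator-out k k f ℕₚ.≤-refl) (Σ<-indicator′ k t f t<k)) (≡ᵇ-refl t) ⟩
    (0ℚ + f t) + 1ℚ * leaves
      ≡⟨ cong₂ _+_ (ℚₚ.+-identityˡ (f t)) (ℚₚ.*-identityˡ leaves) ⟩
    f t + leaves
      ∎
    where
    leaves : ℚ
    leaves = Σ< p (λ j → f (k ℕ.+ j))

  nbrSum-leaf : ∀ {x} f → k ℕ.≤ x → nbrSum x f ≡ f (suc t)
  nbrSum-leaf {x} f k≤x = begin
    nbrSum x f
      ≡⟨ Σ<-split k p (λ y → b2q (broomAdj k x y) * f y) ⟩
    Σ< k (λ y → b2q (broomAdj k x y) * f y) + Σ< p (λ j → b2q (broomAdj k x (k ℕ.+ j)) * f (k ℕ.+ j))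
      ≡⟨ cong₂ _+_ (trans (Σ<-cong k centre) (Σ<-indicator′ k (suc t) f centre<k)) (trans (Σ<-cong p none) (Σ-zero p)) ⟩
    f (suc t) + 0ℚ
      ≡⟨ ℚₚ.+-identityʳ (f (suc t)) ⟩
    f (suc t)
      ∎
    where
    centre : ∀ y → y < k → b2q (broomAdj k x y) * f y ≡ b2q (suc y ≡ᵇ k) * f y
    centre y y<k = cong (λ b → b2q b * f y) (broomAdj-leaf-path k≤x y<k)
    none : ∀ j → j < p → b2q (broomAdj k x (k ℕ.+ j)) * f (k ℕ.+ j) ≡ 0ℚ
    none j _ = trans (cong (λ b → b2q b * f (k ℕ.+ j)) (broomAdj-leaf-leaf k≤x (leaf j))) (ℚₚ.*-zeroˡ (f (k ℕ.+ j)))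

  degree : ℕ → ℚ
  degree x = nbrSum x (λ _ → 1ℚ)

  degree-0 : degree 0 ≡ 1ℚ
  degree-0 = nbrSum-0 (λ _ → 1ℚ)

  degree-inner : ∀ {x} → x < t → degree (suc x) ≡ 2ℚ
  degree-inner x<t = nbrSum-inner (λ _ → 1ℚ) x<t

  degree-centre : degree (suc t) ≡ 1ℚ + fromℕ p
  degree-centre = trans (nbrSum-centre (λ _ → 1ℚ)) (cong (1ℚ +_) (trans (Σ<-const p 1ℚ) (ℚₚ.*-identityʳ (fromℕ p))))

  degree-leaf : ∀ {x} → k ℕ.≤ x → degree x ≡ 1ℚ
  degree-leaf k≤x = nbrSum-leaf (λ _ → 1ℚ) k≤x

  degℚ-broom : ∀ a → degℚ (broom k p) a ≡ degree (toℕ a)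
  degℚ-broom a = trans (degℚ≡Σ (broom k p) a) (Σ-cong (λ b → sym (ℚₚ.*-identityʳ (b2q (broom k p a b)))))

  non-centre : ∀ {x V} → x < k → k ℕ.≤ V → broomAdj k x V ≡ false → x ℕ.≤ t
  non-centre {x} {V} x<k k≤V x≁V with ℕₚ.m≤n⇒m<n∨m≡n (ℕₚ.≤-pred x<k)
  ... | inj₁ x<centre = ℕₚ.≤-pred x<centre
  ... | inj₂ refl with trans (sym x≁V) (trans (broomAdj-path-leaf x<k k≤V) (≡ᵇ-refl k))
  ...   | ()

  dist : ℕ → ℕ → ℚ
  dist x y = fromℕ (broomDist k x y)

  fromℕ-k : fromℕ k ≡ 1ℚ + fromℕ (suc t)
  fromℕ-k = fromℕ-suc (suc t)

  dist-path-path : ∀ {x y} → x < k → y < k → dist x y ≡ fromℕ ∣ x - y ∣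
  dist-path-path x<k y<k = cong fromℕ (broomDist-path-path x<k y<k)

  dist-path-leaf : ∀ {x y} → x < k → k ℕ.≤ y → dist x y ≡ fromℕ k - fromℕ x
  dist-path-leaf x<k k≤y = trans (cong fromℕ (broomDist-path-leaf x<k k≤y)) (fromℕ-∣-∣′ (ℕₚ.<⇒≤ x<k))

  dist-leaf-path : ∀ {x y} → k ℕ.≤ x → y < k → dist x y ≡ fromℕ k - fromℕ y
  dist-leaf-path {x} {y} k≤x y<k = trans (cong fromℕ (broomDist-sym k x y)) (dist-path-leaf y<k k≤x)

  dist-leaf-leaf : ∀ {x y} → k ℕ.≤ x → k ℕ.≤ y → dist x y ≡ (if x ≡ᵇ y then 0ℚ else 2ℚ)
  dist-leaf-leaf {x} {y} k≤x k≤y with x ≡ᵇ y | broomDist-leaf-leaf {k} k≤x k≤y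
  ... | true  | d≡0 = trans (cong fromℕ d≡0) fromℕ-0
  ... | false | d≡2 = trans (cong fromℕ d≡2) fromℕ-2

  dist-leaf : ∀ {x} X → k ℕ.≤ x → dist x X ≡ dist (suc t) X + 1ℚ - 2ℚ * b2q (x ≡ᵇ X)
  dist-leaf {x} X k≤x with X ℕₚ.<? k
  ... | yes X<k = begin
    dist x X
      ≡⟨ dist-leaf-path k≤x X<k ⟩
    fromℕ k - fromℕ X
      ≡⟨ cong (_- fromℕ X) fromℕ-k ⟩
    1ℚ + fromℕ (suc t) - fromℕ X
      ≡⟨ step (fromℕ (suc t)) (fromℕ X) ⟩
    fromℕ (suc t) - fromℕ X + 1ℚ - 2ℚ * 0ℚ
      ≡⟨ cong₂ (λ d b → d + 1ℚ - 2ℚ * b2q b) (sym centre-X) (sym (≡ᵇ-false x≢X)) ⟩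
    dist (suc t) X + 1ℚ - 2ℚ * b2q (x ≡ᵇ X) ∎
    where
    step : ∀ c y → 1ℚ + c - y ≡ c - y + 1ℚ - 2ℚ * 0ℚ
    step = solve-∀ ringℚ
    centre-X : dist (suc t) X ≡ fromℕ (suc t) - fromℕ X
    centre-X = trans (dist-path-path centre<k X<k) (fromℕ-∣-∣ (ℕₚ.≤-pred X<k))
    x≢X : x ≢ X
    x≢X x≡X = ℕₚ.<⇒≱ X<k (subst (k ℕ.≤_) x≡X k≤x)
  ... | no X≮k = begin
    dist x X                                        ≡⟨ dist-leaf-leaf k≤x k≤X ⟩
    (if x ≡ᵇ X then 0ℚ else 2ℚ)                     ≡⟨ step (x ≡ᵇ X) ⟩
    1ℚ + 1ℚ - 2ℚ * b2q (x ≡ᵇ X)                     ≡⟨ cong (λ d → d + 1ℚ - 2ℚ * b2q (x ≡ᵇ X)) centre-X ⟨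
    dist (suc t) X + 1ℚ - 2ℚ * b2q (x ≡ᵇ X)         ∎
    where
    k≤X : k ℕ.≤ X
    k≤X = ℕₚ.≮⇒≥ X≮k
    step : ∀ b → (if b then 0ℚ else 2ℚ) ≡ 1ℚ + 1ℚ - 2ℚ * b2q b
    step true  = refl
    step false = refl
    centre-X : dist (suc t) X ≡ 1ℚ
    centre-X = trans (dist-path-leaf centre<k k≤X) (trans (cong (_- fromℕ (suc t)) fromℕ-k) (cancel (fromℕ (suc t))))
      where
      cancel : ∀ c → 1ℚ + c - c ≡ 1ℚ
      cancel = solve-∀ ringℚ

  dist-from-path : ∀ {x} X → x < k → dist x X ≡ fromℕ ∣ x - X ⊓ k ∣
  dist-from-path X x<k = cong fromℕ (broomDist-from-path x<k)

  ≡ᵇ-⊓ : ∀ {x} X → x < k → (x ≡ᵇ X ⊓ k) ≡ (x ≡ᵇ X)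
  ≡ᵇ-⊓ {x} X x<k with X ℕₚ.<? k
  ... | yes X<k = cong (x ≡ᵇ_) (ℕₚ.m≤n⇒m⊓n≡m (ℕₚ.<⇒≤ X<k))
  ... | no X≮k  = trans (cong (x ≡ᵇ_) (ℕₚ.m≥n⇒m⊓n≡n k≤X))
                        (trans (≡ᵇ-false (ℕₚ.<⇒≢ x<k)) (sym (≡ᵇ-false (ℕₚ.<⇒≢ (ℕₚ.<-≤-trans x<k k≤X)))))
    where
    k≤X : k ℕ.≤ X
    k≤X = ℕₚ.≮⇒≥ X≮k

  ≡ᵇ-+ : ∀ m a b → (m ℕ.+ a ≡ᵇ m ℕ.+ b) ≡ (a ≡ᵇ b)
  ≡ᵇ-+ zero    a b = refl
  ≡ᵇ-+ (suc m) a b = ≡ᵇ-+ m a b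

  Σ-leaves-point : ∀ {X} (f : ℕ → ℚ) → k ℕ.≤ X → X < n → Σ< p (λ j → b2q (k ℕ.+ j ≡ᵇ X) * f j) ≡ f (X ℕ.∸ k)
  Σ-leaves-point {X} f k≤X X<n =
    trans (Σ<-cong p (λ j _ → cong (λ b → b2q b * f j) (trans (cong (k ℕ.+ j ≡ᵇ_) (sym k+[X∸k]≡X)) (≡ᵇ-+ k j (X ℕ.∸ k)))))
          (Σ<-indicator′ p (X ℕ.∸ k) f (ℕₚ.+-cancelˡ-< k (X ℕ.∸ k) p (subst (_< n) (sym k+[X∸k]≡X) X<n)))
    where
    k+[X∸k]≡X : k ℕ.+ (X ℕ.∸ k) ≡ X
    k+[X∸k]≡X = ℕₚ.m+[n∸m]≡n k≤X

  Σ-leaves-indicator : ∀ {X} → X < n → Σ< p (λ j → b2q (k ℕ.+ j ≡ᵇ X) * 1ℚ) ≡ b2q (k ≤ᵇ X)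
  Σ-leaves-indicator {X} X<n with X ℕₚ.<? k
  ... | yes X<k = trans (Σ<-cong p (λ j _ → trans (cong (λ b → b2q b * 1ℚ) (≡ᵇ-false (X<k+j j))) (ℚₚ.*-zeroˡ 1ℚ)))
                        (trans (Σ-zero p) (cong b2q (sym (≤ᵇ-false X<k))))
    where
    X<k+j : ∀ j → k ℕ.+ j ≢ X
    X<k+j j k+j≡X = ℕₚ.<⇒≱ X<k (subst (k ℕ.≤_) k+j≡X (leaf j))
  ... | no X≮k  = trans (Σ-leaves-point (λ _ → 1ℚ) (ℕₚ.≮⇒≥ X≮k) X<n) (cong b2q (sym (≤ᵇ-true (ℕₚ.≮⇒≥ X≮k))))

  -- The step from t to the centre leads away from X, unless X is the centre or a leaf.
  centre-step : ∀ X → (dist (suc t) X - dist t X) + 2ℚ * b2q (k ≤ᵇ X) + 2ℚ * b2q (suc t ≡ᵇ X) ≡ 1ℚ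
  centre-step X with ℕₚ.<-cmp X (suc t)
  ... | tri< X<c _ _ = begin
    (dist (suc t) X - dist t X) + 2ℚ * b2q (k ≤ᵇ X) + 2ℚ * b2q (suc t ≡ᵇ X)
      ≡⟨ cong₂ (λ a b → (a - b) + 2ℚ * b2q (k ≤ᵇ X) + 2ℚ * b2q (suc t ≡ᵇ X))
          (trans (dist-path-path centre<k X<k) (trans (fromℕ-∣-∣ (ℕₚ.<⇒≤ X<c)) (cong (_- fromℕ X) (fromℕ-suc t))))
          (trans (dist-path-path t<k X<k) (fromℕ-∣-∣ (ℕₚ.≤-pred X<c))) ⟩
    (1ℚ + fromℕ t - fromℕ X - (fromℕ t - fromℕ X)) + 2ℚ * b2q (k ≤ᵇ X) + 2ℚ * b2q (suc t ≡ᵇ X)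
      ≡⟨ cong₂ (λ a b → (1ℚ + fromℕ t - fromℕ X - (fromℕ t - fromℕ X)) + 2ℚ * b2q a + 2ℚ * b2q b)
          (≤ᵇ-false X<k) (≡ᵇ-false (ℕₚ.<⇒≢ X<c ∘ sym)) ⟩
    (1ℚ + fromℕ t - fromℕ X - (fromℕ t - fromℕ X)) + 2ℚ * 0ℚ + 2ℚ * 0ℚ
      ≡⟨ step (fromℕ t) (fromℕ X) ⟩
    1ℚ ∎
    where
    X<k : X < k
    X<k = ℕₚ.<-trans X<c centre<k
    step : ∀ τ x → (1ℚ + τ - x - (τ - x)) + 2ℚ * 0ℚ + 2ℚ * 0ℚ ≡ 1ℚ
    step = solve-∀ ringℚ
  ... | tri≈ _ refl _ = begin
    (dist (suc t) (suc t) - dist t (suc t)) + 2ℚ * b2q (k ≤ᵇ suc t) + 2ℚ * b2q (suc t ≡ᵇ suc t)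
      ≡⟨ cong₂ (λ a b → (a - b) + 2ℚ * b2q (k ≤ᵇ suc t) + 2ℚ * b2q (suc t ≡ᵇ suc t))
          (trans (cong fromℕ (broomDist-diag k (suc t))) fromℕ-0)
          (trans (dist-path-path t<k centre<k) (trans (fromℕ-∣-∣′ (ℕₚ.n≤1+n t)) (cong (_- fromℕ t) (fromℕ-suc t)))) ⟩
    (0ℚ - (1ℚ + fromℕ t - fromℕ t)) + 2ℚ * b2q (k ≤ᵇ suc t) + 2ℚ * b2q (suc t ≡ᵇ suc t)
      ≡⟨ cong₂ (λ a b → (0ℚ - (1ℚ + fromℕ t - fromℕ t)) + 2ℚ * b2q a + 2ℚ * b2q b)
          (≤ᵇ-false centre<k) (≡ᵇ-refl (suc t)) ⟩
    (0ℚ - (1ℚ + fromℕ t - fromℕ t)) + 2ℚ * 0ℚ + 2ℚ * 1ℚ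
      ≡⟨ step (fromℕ t) ⟩
    1ℚ ∎
    where
    step : ∀ τ → (0ℚ - (1ℚ + τ - τ)) + 2ℚ * 0ℚ + 2ℚ * 1ℚ ≡ 1ℚ
    step = solve-∀ ringℚ
  ... | tri> _ _ c<X = begin
    (dist (suc t) X - dist t X) + 2ℚ * b2q (k ≤ᵇ X) + 2ℚ * b2q (suc t ≡ᵇ X)
      ≡⟨ cong₂ (λ a b → (a - b) + 2ℚ * b2q (k ≤ᵇ X) + 2ℚ * b2q (suc t ≡ᵇ X))
          (trans (dist-path-leaf centre<k c<X) (cong₂ _-_ fromℕ-k (fromℕ-suc t)))
          (trans (dist-path-leaf t<k c<X) (cong (_- fromℕ t) fromℕ-k)) ⟩
    (1ℚ + fromℕ (suc t) - (1ℚ + fromℕ t) - (1ℚ + fromℕ (suc t) - fromℕ t)) + 2ℚ * b2q (k ≤ᵇ X) + 2ℚ * b2q (suc t ≡ᵇ X)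
      ≡⟨ cong₂ (λ a b → (1ℚ + fromℕ (suc t) - (1ℚ + fromℕ t) - (1ℚ + fromℕ (suc t) - fromℕ t)) + 2ℚ * b2q a + 2ℚ * b2q b)
          (≤ᵇ-true c<X) (≡ᵇ-false (ℕₚ.<⇒≢ c<X)) ⟩
    (1ℚ + fromℕ (suc t) - (1ℚ + fromℕ t) - (1ℚ + fromℕ (suc t) - fromℕ t)) + 2ℚ * 1ℚ + 2ℚ * 0ℚ
      ≡⟨ step (fromℕ (suc t)) (fromℕ t) ⟩
    1ℚ ∎
    where
    step : ∀ c τ → (1ℚ + c - (1ℚ + τ) - (1ℚ + c - τ)) + 2ℚ * 1ℚ + 2ℚ * 0ℚ ≡ 1ℚ
    step = solve-∀ ringℚ

  laplacian-centre : ∀ X → X < n →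
    nbrSum (suc t) (λ y → dist (suc t) X - dist y X) ≡ (2ℚ - degree (suc t)) - 2ℚ * b2q (suc t ≡ᵇ X)
  laplacian-centre X X<n = begin
    nbrSum (suc t) (λ y → dist (suc t) X - dist y X)
      ≡⟨ nbrSum-centre (λ y → dist (suc t) X - dist y X) ⟩
    (dist (suc t) X - dist t X) + Σ< p (λ j → dist (suc t) X - dist (k ℕ.+ j) X)
      ≡⟨ cong ((dist (suc t) X - dist t X) +_) leaves ⟩
    (dist (suc t) X - dist t X) + (2ℚ * Σ< p (λ j → b2q (k ℕ.+ j ≡ᵇ X) * 1ℚ) - fromℕ p * 1ℚ)
      ≡⟨ cong (λ i → (dist (suc t) X - dist t X) + (2ℚ * i - fromℕ p * 1ℚ)) (Σ-leaves-indicator X<n) ⟩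
    (dist (suc t) X - dist t X) + (2ℚ * b2q (k ≤ᵇ X) - fromℕ p * 1ℚ)
      ≡⟨ by-position ⟩
    (2ℚ - (1ℚ + fromℕ p)) - 2ℚ * b2q (suc t ≡ᵇ X)
      ≡⟨ cong (λ d → (2ℚ - d) - 2ℚ * b2q (suc t ≡ᵇ X)) degree-centre ⟨
    (2ℚ - degree (suc t)) - 2ℚ * b2q (suc t ≡ᵇ X)
      ∎
    where
    c : ℚ
    c = dist (suc t) X
    leaf-term : ∀ j → c - dist (k ℕ.+ j) X ≡ 2ℚ * (b2q (k ℕ.+ j ≡ᵇ X) * 1ℚ) - 1ℚ
    leaf-term j = trans (cong (λ d → c - d) (dist-leaf X (leaf j))) (step c (b2q (k ℕ.+ j ≡ᵇ X)))
      where
      step : ∀ c b → c - (c + 1ℚ - 2ℚ * b) ≡ 2ℚ * (b * 1ℚ) - 1ℚ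
      step = solve-∀ ringℚ
    leaves : Σ< p (λ j → c - dist (k ℕ.+ j) X) ≡ 2ℚ * Σ< p (λ j → b2q (k ℕ.+ j ≡ᵇ X) * 1ℚ) - fromℕ p * 1ℚ
    leaves = trans (Σ<-cong p (λ j _ → leaf-term j))
      (trans (Σ-distrib-sub {p} (λ a → 2ℚ * (b2q (k ℕ.+ toℕ a ≡ᵇ X) * 1ℚ)) (λ _ → 1ℚ))
             (cong₂ _-_ (Σ-*ˡ {p} 2ℚ (λ a → b2q (k ℕ.+ toℕ a ≡ᵇ X) * 1ℚ)) (Σ<-const p 1ℚ)))
    balance : ∀ d i e P → d + 2ℚ * i + 2ℚ * e ≡ 1ℚ → d + (2ℚ * i - P * 1ℚ) ≡ (2ℚ - (1ℚ + P)) - 2ℚ * e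
    balance d i e P sum≡1 = trans (regroup d i e P) (trans (cong (λ z → z - P * 1ℚ - 2ℚ * e) sum≡1) (finish P e))
      where
      regroup : ∀ d i e P → d + (2ℚ * i - P * 1ℚ) ≡ (d + 2ℚ * i + 2ℚ * e) - P * 1ℚ - 2ℚ * e
      regroup = solve-∀ ringℚ
      finish : ∀ P e → 1ℚ - P * 1ℚ - 2ℚ * e ≡ (2ℚ - (1ℚ + P)) - 2ℚ * e
      finish = solve-∀ ringℚ
    by-position : (c - dist t X) + (2ℚ * b2q (k ≤ᵇ X) - fromℕ p * 1ℚ) ≡ (2ℚ - (1ℚ + fromℕ p)) - 2ℚ * b2q (suc t ≡ᵇ X)
    by-position = balance (c - dist t X) (b2q (k ≤ᵇ X)) (b2q (suc t ≡ᵇ X)) (fromℕ p) (centre-step X)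

  laplacian-0 : ∀ X → nbrSum 0 (λ y → dist 0 X - dist y X) ≡ (2ℚ - degree 0) - 2ℚ * b2q (0 ≡ᵇ X)
  laplacian-0 X = begin
    nbrSum 0 (λ y → dist 0 X - dist y X)
      ≡⟨ nbrSum-0 (λ y → dist 0 X - dist y X) ⟩
    dist 0 X - dist 1 X
      ≡⟨ cong₂ _-_ (dist-from-path X (s≤s z≤n)) (dist-from-path X (s≤s (s≤s z≤n))) ⟩
    fromℕ ∣ 0 - X ⊓ k ∣ - fromℕ ∣ 1 - X ⊓ k ∣
      ≡⟨ ∣-∣-first-difference (X ⊓ k) ⟩
    (2ℚ - 1ℚ) - 2ℚ * b2q (0 ≡ᵇ X ⊓ k)
      ≡⟨ cong₂ (λ d b → (2ℚ - d) - 2ℚ * b2q b) (sym degree-0) (≡ᵇ-⊓ X (s≤s z≤n)) ⟩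
    (2ℚ - degree 0) - 2ℚ * b2q (0 ≡ᵇ X)
      ∎

  laplacian-inner : ∀ {L} X → L < t →
    nbrSum (suc L) (λ y → dist (suc L) X - dist y X) ≡ (2ℚ - degree (suc L)) - 2ℚ * b2q (suc L ≡ᵇ X)
  laplacian-inner {L} X L<t = begin
    nbrSum (suc L) (λ y → dist (suc L) X - dist y X)
      ≡⟨ nbrSum-inner (λ y → dist (suc L) X - dist y X) L<t ⟩
    (dist (suc L) X - dist (suc (suc L)) X) + (dist (suc L) X - dist L X)
      ≡⟨ cong₃ (λ a b c → (a - b) + (a - c)) (dist-from-path X L+1<k) (dist-from-path X L+2<k) (dist-from-path X L<k) ⟩
    (fromℕ ∣ suc L - X ⊓ k ∣ - fromℕ ∣ suc (suc L) - X ⊓ k ∣) + (fromℕ ∣ suc L - X ⊓ k ∣ - fromℕ ∣ L - X ⊓ k ∣)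
      ≡⟨ ∣-∣-second-difference L (X ⊓ k) ⟩
    (2ℚ - 2ℚ) - 2ℚ * b2q (suc L ≡ᵇ X ⊓ k)
      ≡⟨ cong₂ (λ d b → (2ℚ - d) - 2ℚ * b2q b) (sym (degree-inner L<t)) (≡ᵇ-⊓ X L+1<k) ⟩
    (2ℚ - degree (suc L)) - 2ℚ * b2q (suc L ≡ᵇ X)
      ∎
    where
    L+2<k : suc (suc L) < k
    L+2<k = s≤s (s≤s L<t)
    L+1<k : suc L < k
    L+1<k = ℕₚ.<-trans (ℕₚ.n<1+n (suc L)) L+2<k
    L<k : L < k
    L<k = ℕₚ.<-trans (ℕₚ.n<1+n L) L+1<k

  laplacian-leaf : ∀ {L} X → k ℕ.≤ L →
    nbrSum L (λ y → dist L X - dist y X) ≡ (2ℚ - degree L) - 2ℚ * b2q (L ≡ᵇ X)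
  laplacian-leaf {L} X k≤L = begin
    nbrSum L (λ y → dist L X - dist y X)
      ≡⟨ nbrSum-leaf (λ y → dist L X - dist y X) k≤L ⟩
    dist L X - dist (suc t) X
      ≡⟨ cong (_- dist (suc t) X) (dist-leaf X k≤L) ⟩
    dist (suc t) X + 1ℚ - 2ℚ * b2q (L ≡ᵇ X) - dist (suc t) X
      ≡⟨ step (dist (suc t) X) (b2q (L ≡ᵇ X)) ⟩
    (2ℚ - 1ℚ) - 2ℚ * b2q (L ≡ᵇ X)
      ≡⟨ cong (λ d → (2ℚ - d) - 2ℚ * b2q (L ≡ᵇ X)) (degree-leaf k≤L) ⟨
    (2ℚ - degree L) - 2ℚ * b2q (L ≡ᵇ X)
      ∎
    where
    step : ∀ c b → c + 1ℚ - 2ℚ * b - c ≡ (2ℚ - 1ℚ) - 2ℚ * b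
    step = solve-∀ ringℚ

  laplacian-broom : ∀ L X → X < n →
    nbrSum L (λ y → dist L X - dist y X) ≡ (2ℚ - degree L) - 2ℚ * b2q (L ≡ᵇ X)
  laplacian-broom zero    X _ = laplacian-0 X
  laplacian-broom (suc L) X X<n with ℕₚ.<-cmp L t
  ... | tri< L<t _ _  = laplacian-inner X L<t
  ... | tri≈ _ refl _ = laplacian-centre X X<n
  ... | tri> _ _ t<L  = laplacian-leaf X (s≤s t<L)

  R : Fin n → Fin n → ℚ
  R a b = dist (toℕ a) (toℕ b)

  broom-isResistance : IsResistance (broom k p) R
  broom-isResistance = record
    { symmetric     = λ a b → cong fromℕ (broomDist-sym k (toℕ a) (toℕ b))
    ; zero-diagonal = λ a → trans (cong fromℕ (broomDist-diag k (toℕ a))) fromℕ-0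
    ; potential     = λ a → 2ℚ - degree (toℕ a)
    ; laplacian     = λ l x → trans (laplacian-broom (toℕ l) (toℕ x) (Finₚ.toℕ<n x))
                                    (cong (λ b → (2ℚ - degree (toℕ l)) - 2ℚ * b) (sym (δ-toℕ l x)))
    }

-- Sums over the broom

Σ<-∣-∣ : ∀ m c → c ℕ.≤ m →
  Σ< m (λ j → fromℕ ∣ j - c ∣) ≡ fromℕ c * (fromℕ c + 1ℚ) * ½ + (fromℕ m - fromℕ c) * (fromℕ m - fromℕ c - 1ℚ) * ½
Σ<-∣-∣ m c c≤m = begin
  Σ< m (λ j → fromℕ ∣ j - c ∣)
    ≡⟨ Σ<-split-≤ (λ j → fromℕ ∣ j - c ∣) c≤m ⟩
  Σ< c (λ j → fromℕ ∣ j - c ∣) + Σ< (m ℕ.∸ c) (λ i → fromℕ ∣ c ℕ.+ i - c ∣)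
    ≡⟨ cong₂ _+_ below above ⟩
  fromℕ c * fromℕ c - fromℕ c * (fromℕ c - 1ℚ) * ½ + fromℕ (m ℕ.∸ c) * (fromℕ (m ℕ.∸ c) - 1ℚ) * ½
    ≡⟨ cong (λ z → fromℕ c * fromℕ c - fromℕ c * (fromℕ c - 1ℚ) * ½ + z * (z - 1ℚ) * ½) (fromℕ-∸ m c c≤m) ⟩
  fromℕ c * fromℕ c - fromℕ c * (fromℕ c - 1ℚ) * ½ + (fromℕ m - fromℕ c) * (fromℕ m - fromℕ c - 1ℚ) * ½
    ≡⟨ simplify (fromℕ c) (fromℕ m - fromℕ c) ⟩
  fromℕ c * (fromℕ c + 1ℚ) * ½ + (fromℕ m - fromℕ c) * (fromℕ m - fromℕ c - 1ℚ) * ½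
    ∎
  where
  open ≡-Reasoning
  simplify : ∀ c d → c * c - c * (c - 1ℚ) * ½ + d * (d - 1ℚ) * ½ ≡ c * (c + 1ℚ) * ½ + d * (d - 1ℚ) * ½
  simplify = solve-∀ ringℚ
  below : Σ< c (λ j → fromℕ ∣ j - c ∣) ≡ fromℕ c * fromℕ c - fromℕ c * (fromℕ c - 1ℚ) * ½
  below = trans (Σ<-cong c (λ j j<c → fromℕ-∣-∣′ (ℕₚ.<⇒≤ j<c)))
         (trans (Σ-distrib-sub {c} (λ _ → fromℕ c) (λ a → fromℕ (toℕ a))) (cong₂ _-_ (Σ<-const c (fromℕ c)) (Σ<-id c)))
  above : Σ< (m ℕ.∸ c) (λ i → fromℕ ∣ c ℕ.+ i - c ∣) ≡ fromℕ (m ℕ.∸ c) * (fromℕ (m ℕ.∸ c) - 1ℚ) * ½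
  above = trans (Σ<-cong (m ℕ.∸ c) (λ i _ → cong fromℕ (distance i))) (Σ<-id (m ℕ.∸ c))
    where
    distance : ∀ i → ∣ c ℕ.+ i - c ∣ ≡ i
    distance i = trans (ℕₚ.m≤n⇒∣n-m∣≡n∸m (ℕₚ.m≤m+n c i)) (ℕₚ.m+n∸m≡n c i)

⅓ : ℚ
⅓ = ℤ.+ 1 / 3

-- A ring signature with two models, ℚ and the expressions of the ring solver: a polynomial written
-- once over it is a function on ℚ whose identities `solve` proves from its syntax.
record Arith (A : Set) : Set where
  infixl 6 _⊕_ _⊖_
  infixl 7 _⊗_
  infix  8 ⊝_
  field
    _⊕_ _⊗_ : A → A → A
    ⊝_      : A → A
    const   : ℚ → A

  _⊖_ : A → A → A
  x ⊖ y = x ⊕ ⊝ y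

ℚ-arith : Arith ℚ
ℚ-arith = record { _⊕_ = _+_ ; _⊗_ = _*_ ; ⊝_ = -_ ; const = λ x → x }

syntax-arith : ∀ {n} → Arith (Expr ℚ n)
syntax-arith = record { _⊕_ = E._⊕_ ; _⊗_ = E._⊗_ ; ⊝_ = E.⊝_ ; const = E.Κ }

data Monomial : Set where
  _x^_y^_z^_ : (c i j l : ℕ) → Monomial

-- Closed forms for the broom with k = t + 2, in t, p and the index u of a path vertex, each kept in
-- the shape of a sum over the vertex classes: vertex 0, the inner path vertices, the centre, the leaves.
module Polynomials {A : Set} (arith : Arith A) where
  open Arith arith
  open import Agda.Builtin.FromNat using (Number; fromNat)

  private
    instance
      literals : Number A
      literals = record { Constraint = λ _ → ⊤ ; fromNat = λ n → const (literal n) }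
      trivial : ⊤
      trivial = tt

    sq : A → A
    sq x = x ⊗ x

  quadSum : A → A → A → A → A
  quadSum a b c m = a ⊗ m ⊕ b ⊗ (m ⊗ (m ⊖ 1) ⊗ const ½) ⊕ c ⊗ (m ⊗ (m ⊖ 1) ⊗ (2 ⊗ m ⊖ 1) ⊗ const ⅙)

  edges : A → A → A
  edges t p = 1 ⊕ 2 ⊗ t ⊕ (1 ⊕ p) ⊕ p

  rPath : A → A → A → A
  rPath t p y = y ⊕ 2 ⊗ (y ⊗ (y ⊕ 1) ⊗ const ½ ⊕ (1 ⊕ t ⊖ y) ⊗ (1 ⊕ t ⊖ y ⊖ 1) ⊗ const ½ ⊖ y)
              ⊕ (1 ⊕ p) ⊗ (1 ⊕ t ⊖ y) ⊕ p ⊗ (2 ⊕ t ⊖ y)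

  rPath-shifted : A → A → A → A
  rPath-shifted t p j = (t ⊗ t ⊕ 2 ⊗ t ⊗ p ⊕ p ⊕ 1) ⊕ (2 ⊖ 2 ⊗ t ⊖ 2 ⊗ p) ⊗ j ⊕ 2 ⊗ (j ⊗ j)

  rLeaf : A → A → A
  rLeaf t p = (2 ⊕ t) ⊕ 2 ⊗ (t ⊗ (2 ⊕ t ⊖ 1) ⊖ t ⊗ (t ⊖ 1) ⊗ const ½)
            ⊕ (1 ⊕ p) ⊗ (2 ⊕ t ⊖ (1 ⊕ t)) ⊕ (p ⊗ 2 ⊕ (0 ⊖ 2))

  Wbroom : A → A → A
  Wbroom t p = rPath t p 0 ⊕ 2 ⊗ quadSum (t ⊗ t ⊕ 2 ⊗ t ⊗ p ⊕ p ⊕ 1) (2 ⊖ 2 ⊗ t ⊖ 2 ⊗ p) 2 t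
             ⊕ (1 ⊕ p) ⊗ rPath t p (1 ⊕ t) ⊕ p ⊗ rLeaf t p

  B2 : A → A → A → A
  B2 t p u = sq (2 ⊕ t ⊖ u) ⊕ 2 ⊗ (u ⊗ sq (2 ⊕ t ⊖ u) ⊕ quadSum (sq (t ⊖ u)) (0 ⊖ 4 ⊗ (t ⊖ u)) 4 (t ⊖ u))
           ⊕ (1 ⊕ p) ⊗ sq (2 ⊕ t ⊖ (1 ⊕ t) ⊖ (1 ⊕ t ⊖ u))
           ⊕ (p ⊗ sq (2 ⊖ (2 ⊕ t ⊖ u)) ⊕ (sq (0 ⊖ (2 ⊕ t ⊖ u)) ⊖ sq (2 ⊖ (2 ⊕ t ⊖ u))))

  ρ-broom : A → A → A
  ρ-broom t u = 1 ⊕ (2 ⊕ t ⊖ u)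

  T₁-broom S₁-broom S₂-broom T₂-broom : A → A → A → A
  T₁-broom t p u = Wbroom t p ⊕ 2 ⊗ (rPath t p u ⊕ rLeaf t p) ⊕ 2 ⊗ (2 ⊕ t ⊖ u)
  S₁-broom t p u = const ½ ⊗ (rLeaf t p ⊖ rPath t p u)
  S₂-broom t p u = const ½ ⊗ const ½ ⊗ B2 t p u ⊕ const ½ ⊗ sq (2 ⊕ t ⊖ u)
  T₂-broom t p u = 2 ⊗ (edges t p ⊕ 2) ⊗ S₂-broom t p u ⊖ 2 ⊗ (S₁-broom t p u ⊗ S₁-broom t p u)

  gap : A → A → A → A
  gap t p u = (edges t p ⊕ 2) ⊗ ρ-broom t u ⊗ Wbroom t p ⊖ edges t p ⊗ (ρ-broom t u ⊗ T₁-broom t p u ⊖ T₂-broom t p u)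

  pow : A → ℕ → A
  pow x zero    = 1
  pow x (suc i) = x ⊗ pow x i

  eval₃ : List Monomial → A → A → A → A
  eval₃ []                       x y z = 0
  eval₃ ((c x^ i y^ j z^ l) ∷ ms) x y z = const (literal c) ⊗ (pow x i ⊗ (pow y j ⊗ pow z l)) ⊕ eval₃ ms x y z

open Polynomials ℚ-arith public

module Syntax {n} = Polynomials (syntax-arith {n})

open NonReflective ringℚ using (solve; _⊜_)

rPath-shift : ∀ t p j → rPath t p (1ℚ + j) ≡ rPath-shifted t p j
rPath-shift = solve 3 (λ t p j → Syntax.rPath t p (E.Κ 1ℚ E.⊕ j) ⊜ Syntax.rPath-shifted t p j) refl

module BroomSums (t p : ℕ) where
  open Broom t p
  open ≡-Reasoning

  tℚ pℚ : ℚ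
  tℚ = fromℕ t
  pℚ = fromℕ p

  private
    leaf : ∀ j → k ℕ.≤ k ℕ.+ j
    leaf = ℕₚ.m≤m+n k

    centre<k : suc t < k
    centre<k = ℕₚ.n<1+n (suc t)

  Σ-degree : ∀ (g : ℕ → ℚ) →
    Σ< n (λ y → degree y * g y) ≡ g 0 + 2ℚ * Σ< t (λ j → g (suc j)) + (1ℚ + pℚ) * g (suc t) + Σ< p (λ j → g (k ℕ.+ j))
  Σ-degree g = begin
    Σ< n (λ y → degree y * g y)
      ≡⟨ Σ<-split k p (λ y → degree y * g y) ⟩
    degree 0 * g 0 + Σ< (suc t) (λ j → degree (suc j) * g (suc j)) + Σ< p (λ j → degree (k ℕ.+ j) * g (k ℕ.+ j))
      ≡⟨ cong₂ (λ a b → degree 0 * g 0 + a + b) (Σ<-last t (λ j → degree (suc j) * g (suc j))) leaves ⟩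
    degree 0 * g 0 + (Σ< t (λ j → degree (suc j) * g (suc j)) + degree (suc t) * g (suc t)) + Σ< p (λ j → g (k ℕ.+ j))
      ≡⟨ cong₂ (λ a b → a * g 0 + (b + degree (suc t) * g (suc t)) + Σ< p (λ j → g (k ℕ.+ j))) degree-0 inner ⟩
    1ℚ * g 0 + (2ℚ * Σ< t (λ j → g (suc j)) + degree (suc t) * g (suc t)) + Σ< p (λ j → g (k ℕ.+ j))
      ≡⟨ cong (λ a → 1ℚ * g 0 + (2ℚ * Σ< t (λ j → g (suc j)) + a * g (suc t)) + Σ< p (λ j → g (k ℕ.+ j))) degree-centre ⟩
    1ℚ * g 0 + (2ℚ * Σ< t (λ j → g (suc j)) + (1ℚ + pℚ) * g (suc t)) + Σ< p (λ j → g (k ℕ.+ j))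
      ≡⟨ regroup (g 0) (Σ< t (λ j → g (suc j))) ((1ℚ + pℚ) * g (suc t)) (Σ< p (λ j → g (k ℕ.+ j))) ⟩
    g 0 + 2ℚ * Σ< t (λ j → g (suc j)) + (1ℚ + pℚ) * g (suc t) + Σ< p (λ j → g (k ℕ.+ j))
      ∎
    where
    regroup : ∀ a b c d → 1ℚ * a + (2ℚ * b + c) + d ≡ a + 2ℚ * b + c + d
    regroup = solve-∀ ringℚ
    leaves : Σ< p (λ j → degree (k ℕ.+ j) * g (k ℕ.+ j)) ≡ Σ< p (λ j → g (k ℕ.+ j))
    leaves = Σ<-cong p (λ j _ → trans (cong (_* g (k ℕ.+ j)) (degree-leaf (leaf j))) (ℚₚ.*-identityˡ (g (k ℕ.+ j))))
    inner : Σ< t (λ j → degree (suc j) * g (suc j)) ≡ 2ℚ * Σ< t (λ j → g (suc j))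
    inner = trans (Σ<-cong t (λ j j<t → cong (_* g (suc j)) (degree-inner j<t))) (Σ-*ˡ {t} 2ℚ (λ a → g (suc (toℕ a))))

  Σ-degℚ : ∀ (h : ℕ → ℚ) → Σ (λ a → degℚ (broom k p) a * h (toℕ a)) ≡ Σ< n (λ y → degree y * h y)
  Σ-degℚ h = Σ-cong (λ a → cong (_* h (toℕ a)) (degℚ-broom a))

  Σ-leaves-ifte : ∀ {V} A B → k ℕ.≤ V → V < n → Σ< p (λ j → if k ℕ.+ j ≡ᵇ V then A else B) ≡ pℚ * B + (A - B)
  Σ-leaves-ifte {V} A B k≤V V<n = begin
    Σ< p (λ j → if k ℕ.+ j ≡ᵇ V then A else B)
      ≡⟨ Σ<-cong p (λ j _ → as-indicator (k ℕ.+ j ≡ᵇ V)) ⟩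
    Σ< p (λ j → B + (A - B) * (b2q (k ℕ.+ j ≡ᵇ V) * 1ℚ))
      ≡⟨ Σ-distrib-+ {p} (λ _ → B) (λ a → (A - B) * (b2q (k ℕ.+ toℕ a ≡ᵇ V) * 1ℚ)) ⟩
    Σ< p (λ _ → B) + Σ< p (λ j → (A - B) * (b2q (k ℕ.+ j ≡ᵇ V) * 1ℚ))
      ≡⟨ cong₂ _+_ (Σ<-const p B) (trans (Σ-*ˡ {p} (A - B) (λ a → b2q (k ℕ.+ toℕ a ≡ᵇ V) * 1ℚ))
                                         (cong ((A - B) *_) (Σ-leaves-point (λ _ → 1ℚ) k≤V V<n))) ⟩
    pℚ * B + (A - B) * 1ℚ
      ≡⟨ cong (pℚ * B +_) (ℚₚ.*-identityʳ (A - B)) ⟩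
    pℚ * B + (A - B)
      ∎
    where
    as-indicator : ∀ b → (if b then A else B) ≡ B + (A - B) * (b2q b * 1ℚ)
    as-indicator true  = step A B
      where
      step : ∀ A B → A ≡ B + (A - B) * (1ℚ * 1ℚ)
      step = solve-∀ ringℚ
    as-indicator false = step A B
      where
      step : ∀ A B → B ≡ B + (A - B) * (0ℚ * 1ℚ)
      step = solve-∀ ringℚ

  edges-broom : fromℕ (twiceEdges (broom k p)) ≡ edges tℚ pℚ
  edges-broom = begin
    fromℕ (twiceEdges (broom k p))
      ≡⟨ twiceEdges≡Σdeg (broom k p) ⟩
    Σ (degℚ (broom k p))
      ≡⟨ Σ-cong (λ a → trans (degℚ-broom a) (sym (ℚₚ.*-identityʳ (degree (toℕ a))))) ⟩
    Σ< n (λ y → degree y * 1ℚ)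
      ≡⟨ Σ-degree (λ _ → 1ℚ) ⟩
    1ℚ + 2ℚ * Σ< t (λ _ → 1ℚ) + (1ℚ + pℚ) * 1ℚ + Σ< p (λ _ → 1ℚ)
      ≡⟨ cong₂ (λ a b → 1ℚ + 2ℚ * a + (1ℚ + pℚ) * 1ℚ + b) (Σ<-const t 1ℚ) (Σ<-const p 1ℚ) ⟩
    1ℚ + 2ℚ * (tℚ * 1ℚ) + (1ℚ + pℚ) * 1ℚ + pℚ * 1ℚ
      ≡⟨ cong₃ (λ a b c → 1ℚ + 2ℚ * a + b + c)
               (ℚₚ.*-identityʳ tℚ) (ℚₚ.*-identityʳ (1ℚ + pℚ)) (ℚₚ.*-identityʳ pℚ) ⟩
    edges tℚ pℚ
      ∎

  r-path : ∀ {Y} → Y ℕ.≤ suc t → Σ< n (λ x → degree x * dist x Y) ≡ rPath tℚ pℚ (fromℕ Y)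
  r-path {Y} Y≤c = begin
    Σ< n (λ x → degree x * dist x Y)
      ≡⟨ Σ-degree (λ x → dist x Y) ⟩
    dist 0 Y + 2ℚ * Σ< t (λ j → dist (suc j) Y) + (1ℚ + pℚ) * dist (suc t) Y + Σ< p (λ j → dist (k ℕ.+ j) Y)
      ≡⟨ cong₂ (λ a b → a + 2ℚ * b + (1ℚ + pℚ) * dist (suc t) Y + Σ< p (λ j → dist (k ℕ.+ j) Y))
               (dist-path-path (s≤s z≤n) Y<k) inner ⟩
    y + 2ℚ * (A - y) + (1ℚ + pℚ) * dist (suc t) Y + Σ< p (λ j → dist (k ℕ.+ j) Y)
      ≡⟨ cong₂ (λ a b → y + 2ℚ * (A - y) + (1ℚ + pℚ) * a + b) centre leaves ⟩
    y + 2ℚ * (A - y) + (1ℚ + pℚ) * (1ℚ + tℚ - y) + pℚ * (2ℚ + tℚ - y)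
      ≡⟨ cong (λ c → y + 2ℚ * (y * (y + 1ℚ) * ½ + (c - y) * (c - y - 1ℚ) * ½ - y)
                     + (1ℚ + pℚ) * (1ℚ + tℚ - y) + pℚ * (2ℚ + tℚ - y))
              (fromℕ-suc t) ⟩
    rPath tℚ pℚ y
      ∎
    where
    y A : ℚ
    y = fromℕ Y
    A = y * (y + 1ℚ) * ½ + (fromℕ (suc t) - y) * (fromℕ (suc t) - y - 1ℚ) * ½
    Y<k : Y < k
    Y<k = s≤s Y≤c
    inner : Σ< t (λ j → dist (suc j) Y) ≡ A - y
    inner = begin
      Σ< t (λ j → dist (suc j) Y)
        ≡⟨ Σ<-cong t (λ j j<t → dist-path-path (s≤s (ℕₚ.<-trans j<t (ℕₚ.n<1+n t))) Y<k) ⟩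
      Σ< t (λ j → fromℕ ∣ suc j - Y ∣)
        ≡⟨ add-sub y _ ⟩
      (y + Σ< t (λ j → fromℕ ∣ suc j - Y ∣)) - y
        ≡⟨ cong (_- y) (Σ<-∣-∣ (suc t) Y Y≤c) ⟩
      A - y ∎
      where
      add-sub : ∀ a x → x ≡ (a + x) - a
      add-sub = solve-∀ ringℚ
    centre : dist (suc t) Y ≡ 1ℚ + tℚ - y
    centre = trans (dist-path-path centre<k Y<k) (trans (fromℕ-∣-∣ Y≤c) (cong (_- y) (fromℕ-suc t)))
    leaves : Σ< p (λ j → dist (k ℕ.+ j) Y) ≡ pℚ * (2ℚ + tℚ - y)
    leaves = trans (Σ<-cong p (λ j _ → trans (dist-leaf-path (leaf j) Y<k) (cong (_- y) (fromℕ-2+ t))))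
                   (Σ<-const p (2ℚ + tℚ - y))

  r-leaf : ∀ {V} → k ℕ.≤ V → V < n → Σ< n (λ x → degree x * dist x V) ≡ rLeaf tℚ pℚ
  r-leaf {V} k≤V V<n = begin
    Σ< n (λ x → degree x * dist x V)
      ≡⟨ Σ-degree (λ x → dist x V) ⟩
    dist 0 V + 2ℚ * Σ< t (λ j → dist (suc j) V) + (1ℚ + pℚ) * dist (suc t) V + Σ< p (λ j → dist (k ℕ.+ j) V)
      ≡⟨ cong₂ (λ a b → a + 2ℚ * b + (1ℚ + pℚ) * dist (suc t) V + Σ< p (λ j → dist (k ℕ.+ j) V))
          (trans (cong fromℕ (broomDist-path-leaf (s≤s z≤n) k≤V)) (fromℕ-2+ t)) inner ⟩
    (2ℚ + tℚ) + 2ℚ * (tℚ * (2ℚ + tℚ - 1ℚ) - tℚ * (tℚ - 1ℚ) * ½)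
      + (1ℚ + pℚ) * dist (suc t) V + Σ< p (λ j → dist (k ℕ.+ j) V)
      ≡⟨ cong₂ (λ a b → (2ℚ + tℚ) + 2ℚ * (tℚ * (2ℚ + tℚ - 1ℚ) - tℚ * (tℚ - 1ℚ) * ½) + (1ℚ + pℚ) * a + b)
          (trans (dist-path-leaf centre<k k≤V) (cong₂ _-_ (fromℕ-2+ t) (fromℕ-suc t)))
          (trans (Σ<-cong p (λ j _ → dist-leaf-leaf (leaf j) k≤V)) (Σ-leaves-ifte 0ℚ 2ℚ k≤V V<n)) ⟩
    rLeaf tℚ pℚ
      ∎
    where
    inner : Σ< t (λ j → dist (suc j) V) ≡ tℚ * (2ℚ + tℚ - 1ℚ) - tℚ * (tℚ - 1ℚ) * ½
    inner = begin
      Σ< t (λ j → dist (suc j) V)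
        ≡⟨ Σ<-cong t (λ j j<t → trans (dist-path-leaf (s≤s (ℕₚ.<-trans j<t (ℕₚ.n<1+n t))) k≤V)
                                       (trans (cong₂ _-_ (fromℕ-2+ t) (fromℕ-suc j)) (shift (2ℚ + tℚ) (fromℕ j)))) ⟩
      Σ< t (λ j → (2ℚ + tℚ - 1ℚ) - fromℕ j)
        ≡⟨ Σ-distrib-sub {t} (λ _ → 2ℚ + tℚ - 1ℚ) (λ a → fromℕ (toℕ a)) ⟩
      Σ< t (λ _ → 2ℚ + tℚ - 1ℚ) - Σ< t fromℕ
        ≡⟨ cong₂ _-_ (Σ<-const t (2ℚ + tℚ - 1ℚ)) (Σ<-id t) ⟩
      tℚ * (2ℚ + tℚ - 1ℚ) - tℚ * (tℚ - 1ℚ) * ½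
        ∎
      where
      shift : ∀ K j → K - (1ℚ + j) ≡ (K - 1ℚ) - j
      shift = solve-∀ ringℚ

  private
    r : ℕ → ℚ
    r y = Σ< n (λ x → degree x * dist x y)

  W-broom : weightedResistance (broom k p) R ≡ Wbroom tℚ pℚ
  W-broom = begin
    weightedResistance (broom k p) R
      ≡⟨ Σ-cong column ⟩
    Σ< n (λ y → degree y * r y)
      ≡⟨ Σ-degree r ⟩
    r 0 + 2ℚ * Σ< t (λ j → r (suc j)) + (1ℚ + pℚ) * r (suc t) + Σ< p (λ j → r (k ℕ.+ j))
      ≡⟨ cong₂ (λ a b → a + 2ℚ * b + (1ℚ + pℚ) * r (suc t) + Σ< p (λ j → r (k ℕ.+ j)))
               (trans (r-path z≤n) (cong (rPath tℚ pℚ) fromℕ-0)) inner ⟩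
    rPath tℚ pℚ 0ℚ + 2ℚ * quadSum a b 2ℚ tℚ + (1ℚ + pℚ) * r (suc t) + Σ< p (λ j → r (k ℕ.+ j))
      ≡⟨ cong₂ (λ x y → rPath tℚ pℚ 0ℚ + 2ℚ * quadSum a b 2ℚ tℚ + (1ℚ + pℚ) * x + y)
               (trans (r-path ℕₚ.≤-refl) (cong (rPath tℚ pℚ) (fromℕ-suc t)))
               (trans (Σ<-cong p (λ j j<p → r-leaf (leaf j) (ℕₚ.+-monoʳ-< k j<p))) (Σ<-const p (rLeaf tℚ pℚ))) ⟩
    Wbroom tℚ pℚ
      ∎
    where
    G : Graph n
    G = broom k p
    a b : ℚ
    a = tℚ * tℚ + 2ℚ * tℚ * pℚ + pℚ + 1ℚ
    b = 2ℚ - 2ℚ * tℚ - 2ℚ * pℚ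
    swap : ∀ x y z → x * y * z ≡ y * (x * z)
    swap = solve-∀ ringℚ
    column : ∀ c → Σ (λ a → degℚ G a * degℚ G c * R a c) ≡ degree (toℕ c) * r (toℕ c)
    column c = trans (Σ-cong (λ a → swap (degℚ G a) (degℚ G c) (R a c)))
                     (trans (Σ-*ˡ {n} (degℚ G c) (λ a → degℚ G a * R a c))
                            (cong₂ _*_ (degℚ-broom c) (Σ-degℚ (λ x → dist x (toℕ c)))))
    inner : Σ< t (λ j → r (suc j)) ≡ quadSum a b 2ℚ tℚ
    inner = Σ<-quadratic t (λ j → r (suc j)) a b 2ℚ
      (λ j j<t → trans (r-path (s≤s (ℕₚ.<⇒≤ j<t))) (trans (cong (rPath tℚ pℚ) (fromℕ-suc j)) (rPath-shift tℚ pℚ (fromℕ j))))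

  private
    square : ℚ → ℚ
    square x = x * x

  B2-inner : ∀ {U V} → U ℕ.≤ t → k ℕ.≤ V →
    Σ< t (λ j → square (dist (suc j) V - dist (suc j) U))
      ≡ fromℕ U * square (2ℚ + tℚ - fromℕ U)
        + quadSum (square (tℚ - fromℕ U)) (0ℚ - (2ℚ + 2ℚ) * (tℚ - fromℕ U)) (2ℚ + 2ℚ) (tℚ - fromℕ U)
  B2-inner {U} {V} U≤t k≤V = begin
    Σ< t (λ j → sq (suc j))
      ≡⟨ Σ<-split-≤ (λ j → sq (suc j)) U≤t ⟩
    Σ< U (λ j → sq (suc j)) + Σ< (t ℕ.∸ U) (λ i → sq (suc (U ℕ.+ i)))
      ≡⟨ cong₂ _+_ below above ⟩
    u * square (2ℚ + tℚ - u) + quadSum (square (tℚ - u)) (0ℚ - (2ℚ + 2ℚ) * (tℚ - u)) (2ℚ + 2ℚ) (tℚ - u)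
      ∎
    where
    u : ℚ
    u = fromℕ U
    sq : ℕ → ℚ
    sq y = square (dist y V - dist y U)
    U<k : U < k
    U<k = s≤s (ℕₚ.≤-trans U≤t (ℕₚ.n≤1+n t))
    flat : ∀ K u s → ((K - s) - (u - s)) * ((K - s) - (u - s)) ≡ (K - u) * (K - u)
    flat = solve-∀ ringℚ
    below : Σ< U (λ j → sq (suc j)) ≡ u * square (2ℚ + tℚ - u)
    below = trans (Σ<-cong U (λ j j<U → trans
              (cong₂ (λ x y → square (x - y))
                (trans (dist-path-leaf (ℕₚ.<-≤-trans (s≤s j<U) U<k) k≤V) (cong (_- fromℕ (suc j)) (fromℕ-2+ t)))
                (trans (dist-path-path (ℕₚ.<-≤-trans (s≤s j<U) U<k) U<k) (fromℕ-∣-∣′ j<U)))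
              (flat (2ℚ + tℚ) u (fromℕ (suc j)))))
            (Σ<-const U (square (2ℚ + tℚ - u)))
    slope : ∀ t u i → ((2ℚ + t - (1ℚ + (u + i))) - (1ℚ + (u + i) - u)) * ((2ℚ + t - (1ℚ + (u + i))) - (1ℚ + (u + i) - u))
                      ≡ (t - u) * (t - u) + (0ℚ - (2ℚ + 2ℚ) * (t - u)) * i + (2ℚ + 2ℚ) * (i * i)
    slope = solve-∀ ringℚ
    position : ∀ i → i < t ℕ.∸ U →
               sq (suc (U ℕ.+ i)) ≡ square ((2ℚ + tℚ - (1ℚ + (u + fromℕ i))) - (1ℚ + (u + fromℕ i) - u))
    position i i<t-U = cong₂ (λ x y → square (x - y))
        (trans (dist-path-leaf s<k k≤V) (cong₂ _-_ (fromℕ-2+ t) s≡))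
        (trans (dist-path-path s<k U<k) (trans (fromℕ-∣-∣ (ℕₚ.≤-trans (ℕₚ.m≤m+n U i) (ℕₚ.n≤1+n _))) (cong (_- u) s≡)))
      where
      s≡ : fromℕ (suc (U ℕ.+ i)) ≡ 1ℚ + (u + fromℕ i)
      s≡ = trans (fromℕ-suc (U ℕ.+ i)) (cong (1ℚ +_) (fromℕ-+ U i))
      s<k : suc (U ℕ.+ i) < k
      s<k = s≤s (s≤s (ℕₚ.≤-trans (ℕₚ.+-monoʳ-≤ U (ℕₚ.<⇒≤ i<t-U)) (ℕₚ.≤-reflexive (ℕₚ.m+[n∸m]≡n U≤t))))
    above : Σ< (t ℕ.∸ U) (λ i → sq (suc (U ℕ.+ i)))
            ≡ quadSum (square (tℚ - u)) (0ℚ - (2ℚ + 2ℚ) * (tℚ - u)) (2ℚ + 2ℚ) (tℚ - u)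
    above = trans (Σ<-quadratic (t ℕ.∸ U) (λ i → sq (suc (U ℕ.+ i))) (square (tℚ - u)) (0ℚ - (2ℚ + 2ℚ) * (tℚ - u)) (2ℚ + 2ℚ)
                     (λ i i<t-U → trans (position i i<t-U) (slope tℚ u (fromℕ i))))
                  (cong (quadSum (square (tℚ - u)) (0ℚ - (2ℚ + 2ℚ) * (tℚ - u)) (2ℚ + 2ℚ)) (fromℕ-∸ t U U≤t))

  B2-broom : ∀ {U V} → U ℕ.≤ t → k ℕ.≤ V → V < n →
    Σ< n (λ y → degree y * ((dist y V - dist y U) * (dist y V - dist y U))) ≡ B2 tℚ pℚ (fromℕ U)
  B2-broom {U} {V} U≤t k≤V V<n = begin
    Σ< n (λ y → degree y * sq y)
      ≡⟨ Σ-degree sq ⟩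
    sq 0 + 2ℚ * Σ< t (λ j → sq (suc j)) + (1ℚ + pℚ) * sq (suc t) + Σ< p (λ j → sq (k ℕ.+ j))
      ≡⟨ cong₂ (λ a b → a + 2ℚ * b + (1ℚ + pℚ) * sq (suc t) + Σ< p (λ j → sq (k ℕ.+ j))) sq-0 (B2-inner U≤t k≤V) ⟩
    square K-u + 2ℚ * inner + (1ℚ + pℚ) * sq (suc t) + Σ< p (λ j → sq (k ℕ.+ j))
      ≡⟨ cong₂ (λ a b → square K-u + 2ℚ * inner + (1ℚ + pℚ) * a + b) sq-centre leaves ⟩
    square K-u + 2ℚ * inner + (1ℚ + pℚ) * square (2ℚ + tℚ - (1ℚ + tℚ) - (1ℚ + tℚ - u))
      + (pℚ * square (2ℚ - K-u) + (square (0ℚ - K-u) - square (2ℚ - K-u)))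
      ∎
    where
    u K-u inner : ℚ
    u = fromℕ U
    K-u = 2ℚ + tℚ - u
    inner = u * square K-u + quadSum (square (tℚ - u)) (0ℚ - (2ℚ + 2ℚ) * (tℚ - u)) (2ℚ + 2ℚ) (tℚ - u)
    sq : ℕ → ℚ
    sq y = square (dist y V - dist y U)
    U<k : U < k
    U<k = s≤s (ℕₚ.≤-trans U≤t (ℕₚ.n≤1+n t))
    sq-0 : sq 0 ≡ square K-u
    sq-0 = cong₂ (λ x y → square (x - y)) (trans (cong fromℕ (broomDist-path-leaf (s≤s z≤n) k≤V)) (fromℕ-2+ t))
                                          (dist-path-path (s≤s z≤n) U<k)
    sq-centre : sq (suc t) ≡ square (2ℚ + tℚ - (1ℚ + tℚ) - (1ℚ + tℚ - u))
    sq-centre = cong₂ (λ x y → square (x - y))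
      (trans (dist-path-leaf centre<k k≤V) (cong₂ _-_ (fromℕ-2+ t) (fromℕ-suc t)))
      (trans (dist-path-path centre<k U<k) (trans (fromℕ-∣-∣ (ℕₚ.≤-trans U≤t (ℕₚ.n≤1+n t))) (cong (_- u) (fromℕ-suc t))))
    square-ifte : ∀ b → square ((if b then 0ℚ else 2ℚ) - K-u) ≡ (if b then square (0ℚ - K-u) else square (2ℚ - K-u))
    square-ifte true  = refl
    square-ifte false = refl
    leaves : Σ< p (λ j → sq (k ℕ.+ j)) ≡ pℚ * square (2ℚ - K-u) + (square (0ℚ - K-u) - square (2ℚ - K-u))
    leaves = trans (Σ<-cong p (λ j _ → trans (cong₂ (λ x y → square (x - y)) (dist-leaf-leaf (leaf j) k≤V)
                                                   (trans (dist-leaf-path (leaf j) U<k) (cong (_- u) (fromℕ-2+ t))))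
                                             (square-ifte (k ℕ.+ j ≡ᵇ V))))
                   (Σ-leaves-ifte (square (0ℚ - K-u)) (square (2ℚ - K-u)) k≤V V<n)


-- The sign of the change of Kemeny's constant

*-nonNeg : ∀ {x y} → 0ℚ ≤ x → 0ℚ ≤ y → 0ℚ ≤ x * y
*-nonNeg {x} {y} 0≤x 0≤y = subst (_≤ x * y) (ℚₚ.*-zeroʳ x) (ℚₚ.*-monoˡ-≤-nonNeg x {{ℚ.nonNegative 0≤x}} 0≤y)

pow-nonNeg : ∀ {x} i → 0ℚ ≤ x → 0ℚ ≤ pow x i
pow-nonNeg zero    0≤x = ℚₚ.nonNegative⁻¹ 1ℚ
pow-nonNeg (suc i) 0≤x = *-nonNeg 0≤x (pow-nonNeg i 0≤x)

eval₃-nonNeg : ∀ ms {x y z} → 0ℚ ≤ x → 0ℚ ≤ y → 0ℚ ≤ z → 0ℚ ≤ eval₃ ms x y z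
eval₃-nonNeg []                       _   _   _   = ℚₚ.≤-refl
eval₃-nonNeg ((c x^ i y^ j z^ l) ∷ ms) 0≤x 0≤y 0≤z = ℚₚ.+-mono-≤
  (*-nonNeg (ℚₚ.nonNegative⁻¹ (literal c) {{ℚₚ.normalize-nonNeg c 1}})
            (*-nonNeg (pow-nonNeg i 0≤x) (*-nonNeg (pow-nonNeg j 0≤y) (pow-nonNeg l 0≤z))))
  (eval₃-nonNeg ms 0≤x 0≤y 0≤z)

certificate₁ : List Monomial
certificate₁ =
  1092 x^ 0 y^ 0 z^ 0 ∷ 276 x^ 0 y^ 0 z^ 1 ∷ 3288 x^ 0 y^ 1 z^ 0 ∷ 1072 x^ 0 y^ 1 z^ 1 ∷ 80 x^ 0 y^ 1 z^ 2 ∷ 3720 x^ 0 y^ 2 z^ 0 ∷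
  1208 x^ 0 y^ 2 z^ 1 ∷ 96 x^ 0 y^ 2 z^ 2 ∷ 1952 x^ 0 y^ 3 z^ 0 ∷ 464 x^ 0 y^ 3 z^ 1 ∷ 16 x^ 0 y^ 3 z^ 2 ∷ 468 x^ 0 y^ 4 z^ 0 ∷
  52 x^ 0 y^ 4 z^ 1 ∷ 40 x^ 0 y^ 5 z^ 0 ∷ 1704 x^ 1 y^ 0 z^ 0 ∷ 576 x^ 1 y^ 0 z^ 1 ∷ 48 x^ 1 y^ 0 z^ 2 ∷ 4704 x^ 1 y^ 1 z^ 0 ∷
  1424 x^ 1 y^ 1 z^ 1 ∷ 96 x^ 1 y^ 1 z^ 2 ∷ 4336 x^ 1 y^ 2 z^ 0 ∷ 1056 x^ 1 y^ 2 z^ 1 ∷ 48 x^ 1 y^ 2 z^ 2 ∷ 1600 x^ 1 y^ 3 z^ 0 ∷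
  208 x^ 1 y^ 3 z^ 1 ∷ 200 x^ 1 y^ 4 z^ 0 ∷ 624 x^ 2 y^ 0 z^ 0 ∷ 144 x^ 2 y^ 0 z^ 1 ∷ 1712 x^ 2 y^ 1 z^ 0 ∷ 288 x^ 2 y^ 1 z^ 1 ∷
  1248 x^ 2 y^ 2 z^ 0 ∷ 144 x^ 2 y^ 2 z^ 1 ∷ 256 x^ 2 y^ 3 z^ 0 ∷ 48 x^ 3 y^ 0 z^ 0 ∷ 176 x^ 3 y^ 1 z^ 0 ∷ 96 x^ 3 y^ 2 z^ 0 ∷
  []

certificate₂ : List Monomial
certificate₂ =
  1536 x^ 0 y^ 0 z^ 0 ∷ 384 x^ 0 y^ 0 z^ 1 ∷ 4288 x^ 0 y^ 1 z^ 0 ∷ 1504 x^ 0 y^ 1 z^ 1 ∷ 128 x^ 0 y^ 1 z^ 2 ∷ 4368 x^ 0 y^ 2 z^ 0 ∷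
  1376 x^ 0 y^ 2 z^ 1 ∷ 96 x^ 0 y^ 2 z^ 2 ∷ 2080 x^ 0 y^ 3 z^ 0 ∷ 464 x^ 0 y^ 3 z^ 1 ∷ 16 x^ 0 y^ 3 z^ 2 ∷ 468 x^ 0 y^ 4 z^ 0 ∷
  52 x^ 0 y^ 4 z^ 1 ∷ 40 x^ 0 y^ 5 z^ 0 ∷ 5824 x^ 1 y^ 0 z^ 0 ∷ 2112 x^ 1 y^ 0 z^ 1 ∷ 192 x^ 1 y^ 0 z^ 2 ∷ 10128 x^ 1 y^ 1 z^ 0 ∷
  3008 x^ 1 y^ 1 z^ 1 ∷ 192 x^ 1 y^ 1 z^ 2 ∷ 6592 x^ 1 y^ 2 z^ 0 ∷ 1392 x^ 1 y^ 2 z^ 1 ∷ 48 x^ 1 y^ 2 z^ 2 ∷ 1888 x^ 1 y^ 3 z^ 0 ∷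
  208 x^ 1 y^ 3 z^ 1 ∷ 200 x^ 1 y^ 4 z^ 0 ∷ 2880 x^ 2 y^ 0 z^ 0 ∷ 576 x^ 2 y^ 0 z^ 1 ∷ 3872 x^ 2 y^ 1 z^ 0 ∷ 576 x^ 2 y^ 1 z^ 1 ∷
  1728 x^ 2 y^ 2 z^ 0 ∷ 144 x^ 2 y^ 2 z^ 1 ∷ 256 x^ 2 y^ 3 z^ 0 ∷ 320 x^ 3 y^ 0 z^ 0 ∷ 368 x^ 3 y^ 1 z^ 0 ∷ 96 x^ 3 y^ 2 z^ 0 ∷
  []

-- In w, s, b ≥ 0 with p = k + b: the case u = 1 + w, t = u + s, and the case t = u + 1 + s.
gap-certificate₁ : ∀ w s b → gap (1ℚ + w + s) (2ℚ + (1ℚ + w + s) + b) (1ℚ + w) ≡ ⅓ * eval₃ certificate₁ w s b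
gap-certificate₁ = solve 3 (λ w s b →
  Syntax.gap (E.Κ 1ℚ E.⊕ w E.⊕ s) (E.Κ 2ℚ E.⊕ (E.Κ 1ℚ E.⊕ w E.⊕ s) E.⊕ b) (E.Κ 1ℚ E.⊕ w)
    ⊜ E.Κ ⅓ E.⊗ Syntax.eval₃ certificate₁ w s b) refl

gap-certificate₂ : ∀ w s b → gap (w + (1ℚ + s)) (2ℚ + (w + (1ℚ + s)) + b) w ≡ ⅓ * eval₃ certificate₂ w s b
gap-certificate₂ = solve 3 (λ w s b →
  Syntax.gap (w E.⊕ (E.Κ 1ℚ E.⊕ s)) (E.Κ 2ℚ E.⊕ (w E.⊕ (E.Κ 1ℚ E.⊕ s)) E.⊕ b) w
    ⊜ E.Κ ⅓ E.⊗ Syntax.eval₃ certificate₂ w s b) refl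

⅓-nonNeg : 0ℚ ≤ ⅓
⅓-nonNeg = ℚₚ.nonNegative⁻¹ ⅓ {{ℚₚ.normalize-nonNeg 1 3}}

gap-nonNeg : ∀ {t p u} → u ℕ.≤ t → 1 ℕ.≤ t → suc (suc t) ℕ.≤ p → 0ℚ ≤ gap (fromℕ t) (fromℕ p) (fromℕ u)
gap-nonNeg {t} {p} {suc w} u≤t _ k≤p =
  subst (0ℚ ≤_) (sym (trans (cong₃ gap t≡ p≡ (fromℕ-suc w)) (gap-certificate₁ (fromℕ w) (fromℕ s) (fromℕ b))))
        (*-nonNeg ⅓-nonNeg (eval₃-nonNeg certificate₁ (fromℕ-nonNeg w) (fromℕ-nonNeg s) (fromℕ-nonNeg b)))
  where
  s b : ℕ
  s = t ℕ.∸ suc w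
  b = p ℕ.∸ suc (suc t)
  t≡ : fromℕ t ≡ 1ℚ + fromℕ w + fromℕ s
  t≡ = trans (fromℕ-split u≤t) (cong (_+ fromℕ s) (fromℕ-suc w))
  p≡ : fromℕ p ≡ 2ℚ + (1ℚ + fromℕ w + fromℕ s) + fromℕ b
  p≡ = trans (fromℕ-split k≤p) (cong (_+ fromℕ b) (trans (fromℕ-2+ t) (cong (2ℚ +_) t≡)))
gap-nonNeg {t} {p} {zero} _ 1≤t k≤p =
  subst (0ℚ ≤_) (sym (trans (cong₃ gap t≡ p≡ refl) (gap-certificate₂ (fromℕ 0) (fromℕ s) (fromℕ b))))
        (*-nonNeg ⅓-nonNeg (eval₃-nonNeg certificate₂ (fromℕ-nonNeg 0) (fromℕ-nonNeg s) (fromℕ-nonNeg b)))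
  where
  s b : ℕ
  s = t ℕ.∸ 1
  b = p ℕ.∸ suc (suc t)
  t≡ : fromℕ t ≡ fromℕ 0 + (1ℚ + fromℕ s)
  t≡ = trans (fromℕ-split 1≤t)
             (trans (cong (_+ fromℕ s) fromℕ-1) (sym (trans (cong (_+ (1ℚ + fromℕ s)) fromℕ-0) (ℚₚ.+-identityˡ _))))
  p≡ : fromℕ p ≡ 2ℚ + (fromℕ 0 + (1ℚ + fromℕ s)) + fromℕ b
  p≡ = trans (fromℕ-split k≤p) (cong (_+ fromℕ b) (trans (fromℕ-2+ t) (cong (2ℚ +_) t≡)))

kemeny-gap : ∀ E ρ ρ⁻¹ W T₁ T₂ {κ κ′} →
  E * κ ≡ ½ * W → (E + 2ℚ) * κ′ ≡ ½ * (T₁ - ρ⁻¹ * T₂) → ρ * ρ⁻¹ ≡ 1ℚ →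
  E * (E + 2ℚ) * ρ * κ ≡ E * (E + 2ℚ) * ρ * κ′ + ½ * ((E + 2ℚ) * ρ * W - E * (ρ * T₁ - T₂))
kemeny-gap E ρ ρ⁻¹ W T₁ T₂ {κ} {κ′} Eκ E₂κ′ ρρ⁻¹ = begin
  E * (E + 2ℚ) * ρ * κ
    ≡⟨ regroup₁ E ρ κ ⟩
  (E + 2ℚ) * ρ * (E * κ)
    ≡⟨ cong ((E + 2ℚ) * ρ *_) Eκ ⟩
  (E + 2ℚ) * ρ * (½ * W)
    ≡⟨ expand E ρ ρ⁻¹ W T₁ T₂ ⟩
  E * ρ * (½ * (T₁ - ρ⁻¹ * T₂)) + ½ * Δ + ½ * E * T₂ * (ρ * ρ⁻¹ - 1ℚ)
    ≡⟨ cong (λ z → E * ρ * (½ * (T₁ - ρ⁻¹ * T₂)) + ½ * Δ + ½ * E * T₂ * (z - 1ℚ)) ρρ⁻¹ ⟩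
  E * ρ * (½ * (T₁ - ρ⁻¹ * T₂)) + ½ * Δ + ½ * E * T₂ * (1ℚ - 1ℚ)
    ≡⟨ vanish (E * ρ * (½ * (T₁ - ρ⁻¹ * T₂)) + ½ * Δ) (½ * E * T₂) ⟩
  E * ρ * (½ * (T₁ - ρ⁻¹ * T₂)) + ½ * Δ
    ≡⟨ cong (λ z → E * ρ * z + ½ * Δ) E₂κ′ ⟨
  E * ρ * ((E + 2ℚ) * κ′) + ½ * Δ
    ≡⟨ cong (_+ ½ * Δ) (regroup₂ E ρ κ′) ⟩
  E * (E + 2ℚ) * ρ * κ′ + ½ * Δ ∎
  where
  open ≡-Reasoning
  Δ : ℚ
  Δ = (E + 2ℚ) * ρ * W - E * (ρ * T₁ - T₂)
  regroup₁ : ∀ E ρ κ → E * (E + 2ℚ) * ρ * κ ≡ (E + 2ℚ) * ρ * (E * κ)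
  regroup₁ = solve-∀ ringℚ
  regroup₂ : ∀ E ρ κ → E * ρ * ((E + 2ℚ) * κ) ≡ E * (E + 2ℚ) * ρ * κ
  regroup₂ = solve-∀ ringℚ
  expand : ∀ E ρ ρ⁻¹ W T₁ T₂ → (E + 2ℚ) * ρ * (½ * W)
    ≡ E * ρ * (½ * (T₁ - ρ⁻¹ * T₂)) + ½ * ((E + 2ℚ) * ρ * W - E * (ρ * T₁ - T₂)) + ½ * E * T₂ * (ρ * ρ⁻¹ - 1ℚ)
  expand = solve-∀ ringℚ
  vanish : ∀ x y → x + y * (1ℚ - 1ℚ) ≡ x
  vanish = solve-∀ ringℚ

*-pos : ∀ {x y} → 0ℚ ℚ.< x → 0ℚ ℚ.< y → 0ℚ ℚ.< x * y
*-pos {x} {y} 0<x 0<y = ℚₚ.positive⁻¹ (x * y) {{ℚₚ.pos*pos⇒pos x {{ℚ.positive 0<x}} y {{ℚ.positive 0<y}}}}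

≤-by-gap : ∀ {c x y g} → 0ℚ ℚ.< c → 0ℚ ≤ g → c * x ≡ c * y + ½ * g → y ≤ x
≤-by-gap {c} {x} {y} {g} 0<c 0≤g cx≡ = ℚₚ.*-cancelˡ-≤-pos c {{ℚ.positive 0<c}} (begin
  c * y            ≡⟨ ℚₚ.+-identityʳ (c * y) ⟨
  c * y + 0ℚ       ≤⟨ ℚₚ.+-monoʳ-≤ (c * y) (*-nonNeg (ℚₚ.nonNegative⁻¹ ½ {{ℚₚ.normalize-nonNeg 1 2}}) 0≤g) ⟩
  c * y + ½ * g    ≡⟨ cx≡ ⟨
  c * x            ∎)
  where open ℚₚ.≤-Reasoning

module NewEdge (t p : ℕ) {u v : Fin (suc (suc t) ℕ.+ p)}
               (u≤t : toℕ u ℕ.≤ t) (k≤v : suc (suc t) ℕ.≤ toℕ v) (uv∉E : broom (suc (suc t)) p u v ≡ false) where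

  open Broom t p
  open BroomSums t p
  open ≡-Reasoning

  private
    uℚ : ℚ
    uℚ = fromℕ (toℕ u)

    u<k : toℕ u < k
    u<k = s≤s (ℕₚ.≤-trans u≤t (ℕₚ.n≤1+n t))

    u≢v : u ≢ v
    u≢v refl = ℕₚ.<⇒≱ u<k k≤v

    broom-sym : Symmetric (broom k p)
    broom-sym a b = broomAdj-sym k (toℕ a) (toℕ b)

    Ruv : R u v ≡ 2ℚ + tℚ - uℚ
    Ruv = trans (dist-path-leaf u<k k≤v) (cong (_- uℚ) (fromℕ-2+ t))

    ρ⁻¹ : ℚ
    ρ⁻¹ = inv (suc (k ℕ.∸ toℕ u))

    1+Ruv : 1ℚ + R u v ≡ fromℕ (suc (k ℕ.∸ toℕ u))
    1+Ruv = trans (cong (1ℚ +_) (dist-path-leaf u<k k≤v))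
                  (sym (trans (fromℕ-suc _) (cong (1ℚ +_) (fromℕ-∸ k (toℕ u) (ℕₚ.<⇒≤ u<k)))))

    ρ-inverse : (1ℚ + R u v) * ρ⁻¹ ≡ 1ℚ
    ρ-inverse = trans (cong (_* ρ⁻¹) 1+Ruv) (trans (ℚₚ.*-comm _ ρ⁻¹) (inv-*-fromℕ (k ℕ.∸ toℕ u)))

  open ResistanceUpdate broom-sym broom-isResistance u≢v uv∉E ρ-inverse

  private
    r-u : r u ≡ rPath tℚ pℚ uℚ
    r-u = trans (Σ-degℚ (λ x → dist x (toℕ u))) (r-path (ℕₚ.≤-trans u≤t (ℕₚ.n≤1+n t)))

    r-v : r v ≡ rLeaf tℚ pℚ
    r-v = trans (Σ-degℚ (λ x → dist x (toℕ v))) (r-leaf k≤v (Finₚ.toℕ<n v))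

    Σd : Σ d ≡ edges tℚ pℚ
    Σd = trans (sym (twiceEdges≡Σdeg (broom k p))) edges-broom

    D : ℚ
    D = 2ℚ + tℚ - uℚ

    α-u : α u ≡ ½ * (D - 0ℚ)
    α-u = cong₂ (λ x y → ½ * (x - y)) Ruv (zero-diagonal u)
      where open IsResistance broom-isResistance

    α-v : α v ≡ ½ * (0ℚ - D)
    α-v = cong₂ (λ x y → ½ * (x - y)) (zero-diagonal v) (trans (symmetric v u) Ruv)
      where open IsResistance broom-isResistance

    Σdα : Σ (λ a → d a * α a) ≡ ½ * (rLeaf tℚ pℚ - rPath tℚ pℚ uℚ)
    Σdα = begin
      Σ (λ a → d a * α a)                                ≡⟨ Σ-cong (λ a → halve (d a) (R a v) (R a u)) ⟩
      Σ (λ a → ½ * (d a * R a v - d a * R a u))          ≡⟨ Σ-*ˡ ½ (λ a → d a * R a v - d a * R a u) ⟩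
      ½ * Σ (λ a → d a * R a v - d a * R a u)            ≡⟨ cong (½ *_) (Σ-distrib-sub (λ a → d a * R a v) (λ a → d a * R a u)) ⟩
      ½ * (r v - r u)                                    ≡⟨ cong₂ (λ x y → ½ * (x - y)) r-v r-u ⟩
      ½ * (rLeaf tℚ pℚ - rPath tℚ pℚ uℚ)                 ∎
      where
      halve : ∀ x y z → x * (½ * (y - z)) ≡ ½ * (x * y - x * z)
      halve = solve-∀ ringℚ

    Σdα² : Σ (λ a → d a * (α a * α a)) ≡ ½ * ½ * B2 tℚ pℚ uℚ
    Σdα² = begin
      Σ (λ a → d a * (α a * α a))                        ≡⟨ Σ-cong (λ a → quarter (d a) (R a v - R a u)) ⟩
      Σ (λ a → ½ * ½ * (d a * sq (R a v - R a u)))       ≡⟨ Σ-*ˡ (½ * ½) (λ a → d a * sq (R a v - R a u)) ⟩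
      ½ * ½ * Σ (λ a → d a * sq (R a v - R a u))         ≡⟨ cong (½ * ½ *_) (Σ-degℚ (λ x → sq (dist x (toℕ v) - dist x (toℕ u)))) ⟩
      ½ * ½ * Σ< n (λ y → degree y * sq (dist y (toℕ v) - dist y (toℕ u)))
                                                         ≡⟨ cong (½ * ½ *_) (B2-broom u≤t k≤v (Finₚ.toℕ<n v)) ⟩
      ½ * ½ * B2 tℚ pℚ uℚ                                ∎
      where
      sq : ℚ → ℚ
      sq x = x * x
      quarter : ∀ x y → x * (½ * y * (½ * y)) ≡ ½ * ½ * (x * (y * y))
      quarter = solve-∀ ringℚ

    S₁≡ : S₁ ≡ S₁-broom tℚ pℚ uℚ
    S₁≡ = trans (cong₃ (λ x y z → x + (y + z)) Σdα α-u α-v) (cancel (rLeaf tℚ pℚ - rPath tℚ pℚ uℚ) D)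
      where
      cancel : ∀ s D → ½ * s + (½ * (D - 0ℚ) + ½ * (0ℚ - D)) ≡ ½ * s
      cancel = solve-∀ ringℚ

    S₂≡ : S₂ ≡ S₂-broom tℚ pℚ uℚ
    S₂≡ = trans (cong₃ (λ x y z → x + (y * y + z * z)) Σdα² α-u α-v) (collect (B2 tℚ pℚ uℚ) D)
      where
      collect : ∀ b D → ½ * ½ * b + (½ * (D - 0ℚ) * (½ * (D - 0ℚ)) + ½ * (0ℚ - D) * (½ * (0ℚ - D)))
                        ≡ ½ * ½ * b + ½ * (D * D)
      collect = solve-∀ ringℚ

    W′≡ : weightedResistance G′ R′ ≡ T₁-broom tℚ pℚ uℚ - ρ⁻¹ * T₂-broom tℚ pℚ uℚ
    W′≡ = trans weightedResistance-addEdge (cong₂ (λ x y → x - ρ⁻¹ * y)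
      (cong₃ (λ w x y → w + 2ℚ * x + 2ℚ * y) W-broom (cong₂ _+_ r-u r-v) Ruv)
      (cong₃ (λ e s₂ s₁ → 2ℚ * (e + 2ℚ) * s₂ - 2ℚ * (s₁ * s₁)) Σd S₂≡ S₁≡))

  module _ {m m′ : Fin n → Fin n → ℚ} (mfpt : IsMFPT (broom k p) m) (mfpt′ : IsMFPT G′ m′) (i : Fin n) where

    private
      instance
        edges≢0 : ℕ.NonZero (twiceEdges (broom k p))
        edges≢0 = ℕ.>-nonZero (twiceEdges-pos (broom k p) zero (suc zero) refl)
        edges′≢0 : ℕ.NonZero (twiceEdges G′)
        edges′≢0 = ℕ.>-nonZero (twiceEdges-pos G′ zero (suc zero) refl)

      twiceEdges′ : fromℕ (twiceEdges G′) ≡ edges tℚ pℚ + 2ℚ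
      twiceEdges′ = trans twiceEdges-addEdge (cong (_+ 2ℚ) edges-broom)

      kemeny : edges tℚ pℚ * kemenyAt (broom k p) m i ≡ ½ * Wbroom tℚ pℚ
      kemeny = trans (cong (_* kemenyAt (broom k p) m i) (sym edges-broom))
                     (trans (kemeny-resistance broom-sym broom-isResistance mfpt i) (cong (½ *_) W-broom))

      kemeny′ : (edges tℚ pℚ + 2ℚ) * kemenyAt G′ m′ i ≡ ½ * (T₁-broom tℚ pℚ uℚ - ρ⁻¹ * T₂-broom tℚ pℚ uℚ)
      kemeny′ = trans (cong (_* kemenyAt G′ m′ i) (sym twiceEdges′))
                      (trans (kemeny-resistance addEdge-sym isResistance′ mfpt′ i) (cong (½ *_) W′≡))

      ρρ⁻¹ : ρ-broom tℚ uℚ * ρ⁻¹ ≡ 1ℚ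
      ρρ⁻¹ = trans (cong (λ x → (1ℚ + x) * ρ⁻¹) (sym Ruv)) ρ-inverse

      factor-pos : 0ℚ ℚ.< edges tℚ pℚ * (edges tℚ pℚ + 2ℚ) * ρ-broom tℚ uℚ
      factor-pos = *-pos (*-pos E>0 (subst (0ℚ ℚ.<_) twiceEdges′ (fromℕ-pos (twiceEdges G′))))
                         (subst (0ℚ ℚ.<_) (trans (sym 1+Ruv) (cong (1ℚ +_) Ruv)) (fromℕ-suc-pos _))
        where
        E>0 : 0ℚ ℚ.< edges tℚ pℚ
        E>0 = subst (0ℚ ℚ.<_) edges-broom (fromℕ-pos (twiceEdges (broom k p)))

    kemeny-decreases : 1 ℕ.≤ t → k ℕ.≤ p → kemenyAt G′ m′ i ≤ kemenyAt (broom k p) m i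
    kemeny-decreases 1≤t k≤p = ≤-by-gap factor-pos (gap-nonNeg u≤t 1≤t k≤p)
      (kemeny-gap (edges tℚ pℚ) (ρ-broom tℚ uℚ) ρ⁻¹ (Wbroom tℚ pℚ) (T₁-broom tℚ pℚ uℚ) (T₂-broom tℚ pℚ uℚ) kemeny kemeny′ ρρ⁻¹)

theorem5p13 : (k p : ℕ) → 3 Data.Nat.≤ k → k Data.Nat.≤ p →
    (u v : Fin (k Data.Nat.+ p)) → toℕ u < k → k Data.Nat.≤ toℕ v →
    broom k p u v ≡ false →
    (m m′ : Fin (k Data.Nat.+ p) → Fin (k Data.Nat.+ p) → Data.Rational.ℚ) →
    IsMFPT (broom k p) m → IsMFPT (addEdge (broom k p) u v) m′ →
    (i : Fin (k Data.Nat.+ p)) →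
    kemenyAt (addEdge (broom k p) u v) m′ i Data.Rational.≤ kemenyAt (broom k p) m i
theorem5p13 (suc (suc (suc t))) p (s≤s (s≤s (s≤s _))) k≤p u v u<k k≤v uv∉E m m′ mfpt mfpt′ i =
  NewEdge.kemeny-decreases (suc t) p u≤t k≤v uv∉E mfpt mfpt′ i (s≤s z≤n) k≤p
  where
  u≤t : toℕ u ℕ.≤ suc t
  u≤t = Broom.non-centre (suc t) p u<k k≤v uv∉E
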